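{- Let $\epsilon>0$ and $\gamma \ge 1$ be constants and let $V$ be a set of $n$ vertices. Suppose that $\mathcal{M}$ is an $\epsilon$-edge differentially private mechanism in the centralized model that estimates the coreness of every vertex in a given graph $G$ on $V$ such that, for every graph $G$ on $V$, with probability at least $p$ the following holds simultaneously for all $v \in V$: the estimated coreness $\tilde{k}(v)$ and the actual coreness $k(v)$ of $v$ satisfy \[ \gamma^{ -1} k(v) - \alpha \le \tilde{k}(v) \le \gamma k(v) + \alpha . \] Then $\alpha = \Omega(\gamma^{ -1}\log (np))$.
   Context: Graphs are finite, simple, undirected, unweighted. The coreness $k(v)=k_G(v)$ of a vertex $v$ in $G$ is the largest integer $k$ such that there is a subgraph $H$ of $G$ containing $v$ in which every vertex $u \in V(H)$ has $\deg_H(u)\ge k$. A (centralized) mechanism is a randomized algorithm $\mathcal{M}$ mapping a graph $G$ on $V$ to a random vector $(\tilde k(v))_{v\in V}\in\mathbb{R}^V$. It is $\epsilon$-edge differentially private if for all graphs $G,G'$ on $V$ that differ in at most one edge and all sets $Y$ of outputs, $\Pr[\mathcal{M}(G)\in Y]\le e^{\epsilon}\Pr[\mathcal{M}(G')\in Y]$. Here $p\in(0,1]$ and $\alpha\ge 0$ may depend on $n$. The $\Omega$ notation is asymptotic as $np\to\infty$ with $\epsilon$ and $\gamma$ fixed, and the hidden constant may depend on $\epsilon$. -}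

module Defs where

open import Level using (0ℓ)
open import Data.Bool using (Bool; true; false; T; _∧_)
open import Data.Bool.Properties using (T-∧; ∧-comm)
open import Data.Empty using (⊥-elim)
open import Data.Fin using (Fin; toℕ; fromℕ<)
open import Data.Fin.Properties using (all?; toℕ<n; fromℕ<-toℕ; toℕ-fromℕ<)
open import Data.Fin.Subset using (Subset; _∈_; ∣_∣; ⊤)
open import Data.Fin.Subset.Properties
  using (_∈?_; anySubset?; p⊆q⇒∣p∣≤∣q∣; ∣p∣≤n; ∈⊤)
open import Data.Integer using (+_)
open import Data.Nat as ℕ using (ℕ; zero; suc)
import Data.Nat.Properties as ℕₚ
open import Data.Product using (Σ; ∃; _×_; _,_; proj₁; proj₂)
open import Data.Rational as ℚ using (ℚ; 0ℚ; 1ℚ; ½)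
import Data.Rational.Properties as ℚₚ
import Data.Rational.Unnormalised as ℚᵘ
import Data.Rational.Unnormalised.Properties as ℚᵘₚ
import Data.Integer.Properties as ℤₚ
open import Data.Rational.Solver using (module +-*-Solver)
open import Data.Sum using (_⊎_; inj₁; inj₂; [_,_]′)
open import Data.Unit using (tt)
open import Data.Vec using (tabulate; lookup)
open import Data.Vec.Properties using (lookup∘tabulate; []=⇒lookup; lookup⇒[]=)
open import Function using (_∘_; Equivalence)
open import Relation.Binary.PropositionalEquality
  using (_≡_; _≢_; refl; sym; trans; cong; cong₂; subst; subst₂)
open import Relation.Nullary using (¬_; Dec; yes; no)
import Relation.Nullary.Decidable as Dec
open import Relation.Unary using (Pred; _⊆_; _≐_; _∪_; ∁; ⋃; U; ∅)

module Rat where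
  open import Data.Rational hiding (∣_∣)
  open import Data.Rational.Properties
  open ≤-Reasoning
  open +-*-Solver

  ι : ℕ → ℚ
  ι n = + n / 1

  ι-suc : ∀ n → ι (suc n) ≡ 1ℚ + ι n
  ι-suc n = toℚᵘ-injective (ℚᵘₚ.≃-trans (toℚᵘ-fromℚᵘ (ℚᵘ.mkℚᵘ (+ suc n) 0))
    (ℚᵘₚ.≃-sym (ℚᵘₚ.≃-trans (toℚᵘ-homo-+ 1ℚ (ι n))
      (ℚᵘₚ.≃-trans (ℚᵘₚ.+-congʳ ℚᵘ.1ℚᵘ (toℚᵘ-fromℚᵘ (ℚᵘ.mkℚᵘ (+ n) 0)))
        (ℚᵘ.*≡* (cong (λ z → (+ 1 Data.Integer.+ z) Data.Integer.* + 1)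
          (ℤₚ.*-identityʳ (+ n))))))))

  ι-pos : ∀ n → Positive (ι (suc n))
  ι-pos n = normalize-pos (suc n) 1

  ι-nonZero : ∀ n → NonZero (ι (suc n))
  ι-nonZero n = pos⇒nonZero (ι (suc n)) {{ι-pos n}}

  1/1+ : ℕ → ℚ
  1/1+ k = (1/ ι (suc k)) {{ι-nonZero k}}

  0≤ι : ∀ n → 0ℚ ≤ ι n
  0≤ι n = nonNegative⁻¹ (ι n) {{normalize-nonNeg n 1}}

  0<1 : 0ℚ < 1ℚ
  0<1 = positive⁻¹ 1ℚ {{normalize-pos 1 1}}

  1≥0 : 0ℚ ≤ 1ℚ
  1≥0 = <⇒≤ 0<1

  0<½ : 0ℚ < ½
  0<½ = positive⁻¹ ½ {{normalize-pos 1 2}}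

  ι-mono : ∀ {m n} → m ℕ.≤ n → ι m ≤ ι n
  ι-mono {n = n} ℕ.z≤n = 0≤ι n
  ι-mono {suc m} {suc n} (ℕ.s≤s p) =
    subst₂ _≤_ (sym (ι-suc m)) (sym (ι-suc n)) (+-monoʳ-≤ 1ℚ (ι-mono p))

  ι≥ : ∀ q → ∃ λ n → q ≤ ι n
  ι≥ q@(mkℚ (+ n) d c) = n , toℚᵘ-cancel-≤
    (ℚᵘₚ.≤-trans (ℚᵘ.*≤* (subst (Data.Integer._≤ (+ n Data.Integer.* + suc d))
        (sym (ℤₚ.*-identityʳ (+ n)))
        (subst (+ n Data.Integer.≤_) (ℤₚ.pos-* n (suc d))
          (Data.Integer.+≤+ (ℕₚ.m≤m*n n (suc d))))))
      (ℚᵘₚ.≤-reflexive (ℚᵘₚ.≃-sym (toℚᵘ-fromℚᵘ (ℚᵘ.mkℚᵘ (+ n) 0)))))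
  ι≥ q@(mkℚ (Data.Integer.-[1+ n ]) d c) = 0 , nonPositive⁻¹ q

  *-mono : ∀ {a b c d} → 0ℚ ≤ c → 0ℚ ≤ b → a ≤ b → c ≤ d → a * c ≤ b * d
  *-mono {a} {b} {c} {d} 0≤c 0≤b a≤b c≤d = ≤-trans
    (*-monoʳ-≤-nonNeg c {{nonNegative 0≤c}} a≤b)
    (*-monoˡ-≤-nonNeg b {{nonNegative 0≤b}} c≤d)

  0≤* : ∀ {a b} → 0ℚ ≤ a → 0ℚ ≤ b → 0ℚ ≤ a * b
  0≤* {a} {b} p q =
    subst (_≤ a * b) (*-zeroˡ b) (*-monoʳ-≤-nonNeg b {{nonNegative q}} p)

  0<* : ∀ {a b} → 0ℚ < a → 0ℚ < b → 0ℚ < a * b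
  0<* {a} {b} p q =
    subst (_< a * b) (*-zeroˡ b) (*-monoˡ-<-pos b {{positive q}} p)

  0≤+ : ∀ {a b} → 0ℚ ≤ a → 0ℚ ≤ b → 0ℚ ≤ a + b
  0≤+ {a} {b} p q = subst (_≤ a + b) (+-identityˡ 0ℚ) (+-mono-≤ p q)

  0<+1 : ∀ {a} → 0ℚ ≤ a → 0ℚ < a + 1ℚ
  0<+1 {a} p = subst (_< a + 1ℚ) (+-identityˡ 0ℚ) (+-mono-≤-< p 0<1)

  ½+½ : ∀ q → q * ½ + q * ½ ≡ q
  ½+½ q = trans (sym (*-distribˡ-+ q ½ ½)) (*-identityʳ q)

  0<½* : ∀ {q} → 0ℚ < q → 0ℚ < q * ½
  0<½* p = 0<* p 0<½

  dist : ℚ → ℚ → ℚ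
  dist p q = ℚ.∣ p - q ∣

  dist-sym : ∀ p q → dist p q ≡ dist q p
  dist-sym p q = trans (sym (∣-p∣≡∣p∣ (p - q)))
    (cong ℚ.∣_∣ (solve 2 (λ p q → :- (p :- q) := q :- p) refl p q))

  dist-tri : ∀ p q r → dist p r ≤ dist p q + dist q r
  dist-tri p q r = subst (λ z → ℚ.∣ z ∣ ≤ dist p q + dist q r)
    (solve 3 (λ p q r → (p :- q) :+ (q :- r) := p :- r) refl p q r)
    (∣p+q∣≤∣p∣+∣q∣ (p - q) (q - r))

  dist-+ : ∀ a b c d → dist (a + b) (c + d) ≤ dist a c + dist b d
  dist-+ a b c d = subst (λ z → ℚ.∣ z ∣ ≤ dist a c + dist b d)
    (solve 4 (λ a b c d → (a :- c) :+ (b :- d) := (a :+ b) :- (c :+ d)) refl a b c d)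
    (∣p+q∣≤∣p∣+∣q∣ (a - c) (b - d))

  dist-* : ∀ a b c d → dist (a * b) (c * d) ≤ ℚ.∣ a ∣ * dist b d + dist a c * ℚ.∣ d ∣
  dist-* a b c d = begin
    dist (a * b) (c * d)
      ≡⟨ cong ℚ.∣_∣ (solve 4 (λ a b c d →
           a :* b :- c :* d := a :* (b :- d) :+ (a :- c) :* d) refl a b c d) ⟩
    ℚ.∣ a * (b - d) + (a - c) * d ∣
      ≤⟨ ∣p+q∣≤∣p∣+∣q∣ (a * (b - d)) ((a - c) * d) ⟩
    ℚ.∣ a * (b - d) ∣ + ℚ.∣ (a - c) * d ∣
      ≡⟨ cong₂ _+_ (∣p*q∣≡∣p∣*∣q∣ a (b - d)) (∣p*q∣≡∣p∣*∣q∣ (a - c) d) ⟩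
    ℚ.∣ a ∣ * dist b d + dist a c * ℚ.∣ d ∣ ∎

  ∣∣≤ : ∀ p q → ℚ.∣ p ∣ ≤ ℚ.∣ q ∣ + dist p q
  ∣∣≤ p q = subst (λ z → ℚ.∣ z ∣ ≤ ℚ.∣ q ∣ + dist p q)
    (solve 2 (λ p q → q :+ (p :- q) := p) refl p q) (∣p+q∣≤∣p∣+∣q∣ q (p - q))

  p≤∣p∣ : ∀ p → p ≤ ℚ.∣ p ∣
  p≤∣p∣ p with ≤-total 0ℚ p
  ... | inj₁ 0≤p = ≤-reflexive (sym (0≤p⇒∣p∣≡p 0≤p))
  ... | inj₂ p≤0 = ≤-trans p≤0 (0≤∣p∣ p)

  divide : ∀ {δ B} (0<B : 0ℚ < B) →
    δ * ((1/ B) {{>-nonZero 0<B}}) * B ≡ δ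
  divide {δ} {B} 0<B = trans (*-assoc δ _ B)
    (trans (cong (δ *_) (*-inverseˡ B {{>-nonZero 0<B}})) (*-identityʳ δ))

  0<1/ : ∀ {B} (0<B : 0ℚ < B) → 0ℚ < (1/ B) {{>-nonZero 0<B}}
  0<1/ {B} 0<B = positive⁻¹ ((1/ B) {{>-nonZero 0<B}}) {{1/pos⇒pos B {{positive 0<B}}}}

  Cauchy : (ℕ → ℚ) → Set
  Cauchy s = ∀ δ → 0ℚ < δ → ∃ λ N → ∀ m n → N ℕ.≤ m → N ℕ.≤ n → dist (s m) (s n) < δ

  Cauchy-upto : ∀ s C → 0ℚ ≤ C →
    (∀ δ → 0ℚ < δ → ∃ λ N → ∀ m n → N ℕ.≤ m → N ℕ.≤ n → dist (s m) (s n) ≤ δ * C) →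
    Cauchy s
  Cauchy-upto s C 0≤C h δ 0<δ =
    let 0<C+1 = 0<+1 0≤C
        δ' = δ * (1/ (C + 1ℚ)) {{>-nonZero 0<C+1}}
        0<δ' = 0<* 0<δ (0<1/ 0<C+1)
        (N , hN) = h δ' 0<δ'
    in N , λ m n N≤m N≤n → begin-strict
         dist (s m) (s n)  ≤⟨ hN m n N≤m N≤n ⟩
         δ' * C            <⟨ *-monoʳ-<-pos δ' {{positive 0<δ'}}
                                (subst (_< C + 1ℚ) (+-identityʳ C)
                                  (+-monoʳ-< C 0<1)) ⟩
         δ' * (C + 1ℚ)     ≡⟨ divide 0<C+1 ⟩
         δ ∎

  EventuallyBounded : (ℕ → ℚ) → Set
  EventuallyBounded s =
    ∃ λ B → 0ℚ ≤ B × ∃ λ N → ∀ n → N ℕ.≤ n → ℚ.∣ s n ∣ ≤ B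

  Cauchy⇒bounded : ∀ s → Cauchy s → EventuallyBounded s
  Cauchy⇒bounded s c =
    let (N , h) = c 1ℚ 0<1
    in ℚ.∣ s N ∣ + 1ℚ , 0≤+ (0≤∣p∣ (s N)) 1≥0 , N ,
       λ n N≤n → ≤-trans (∣∣≤ (s n) (s N))
         (+-monoʳ-≤ ℚ.∣ s N ∣ (<⇒≤ (h n N N≤n ℕₚ.≤-refl)))

  const-cauchy : ∀ q → Cauchy (λ _ → q)
  const-cauchy q δ 0<δ = 0 , λ _ _ _ _ →
    subst (_< δ) (cong ℚ.∣_∣ (sym (+-inverseʳ q))) 0<δ

  +-cauchy : ∀ s t → Cauchy s → Cauchy t → Cauchy (λ n → s n + t n)
  +-cauchy s t cs ct δ 0<δ =
    let (M , hM) = cs (δ * ½) (0<½* 0<δ)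
        (N , hN) = ct (δ * ½) (0<½* 0<δ)
    in M ℕ.⊔ N , λ m n p q → ≤-<-trans (dist-+ (s m) (t m) (s n) (t n))
         (subst (dist (s m) (s n) + dist (t m) (t n) <_) (½+½ δ)
           (+-mono-< (hM m n (ℕₚ.m⊔n≤o⇒m≤o M N p) (ℕₚ.m⊔n≤o⇒m≤o M N q))
                     (hN m n (ℕₚ.m⊔n≤o⇒n≤o M N p) (ℕₚ.m⊔n≤o⇒n≤o M N q))))

  neg-cauchy : ∀ s → Cauchy s → Cauchy (λ n → - s n)
  neg-cauchy s cs δ 0<δ =
    let (N , h) = cs δ 0<δ
    in N , λ m n p q → subst (_< δ)
         (trans (dist-sym (s m) (s n)) (cong ℚ.∣_∣
           (solve 2 (λ a b → b :- a := (:- a) :- (:- b)) refl (s m) (s n))))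
         (h m n p q)

  *-cauchy : ∀ s t → Cauchy s → Cauchy t → Cauchy (λ n → s n * t n)
  *-cauchy s t cs ct =
    let (A , 0≤A , M₁ , hA) = Cauchy⇒bounded s cs
        (B , 0≤B , N₁ , hB) = Cauchy⇒bounded t ct
    in Cauchy-upto (λ n → s n * t n) (A + B) (0≤+ 0≤A 0≤B) λ δ 0<δ →
      let (M , hM) = cs δ 0<δ
          (N , hN) = ct δ 0<δ
          K = (M₁ ℕ.⊔ N₁) ℕ.⊔ (M ℕ.⊔ N)
          l = λ {k} (p : K ℕ.≤ k) → ℕₚ.m⊔n≤o⇒m≤o (M₁ ℕ.⊔ N₁) (M ℕ.⊔ N) p
          r = λ {k} (p : K ℕ.≤ k) → ℕₚ.m⊔n≤o⇒n≤o (M₁ ℕ.⊔ N₁) (M ℕ.⊔ N) p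
      in K , λ m n p q → begin
        dist (s m * t m) (s n * t n)
          ≤⟨ dist-* (s m) (t m) (s n) (t n) ⟩
        ℚ.∣ s m ∣ * dist (t m) (t n) + dist (s m) (s n) * ℚ.∣ t n ∣
          ≤⟨ +-mono-≤
               (*-mono (0≤∣p∣ (t m - t n)) 0≤A (hA m (ℕₚ.m⊔n≤o⇒m≤o M₁ N₁ (l p)))
                 (<⇒≤ (hN m n (ℕₚ.m⊔n≤o⇒n≤o M N (r p)) (ℕₚ.m⊔n≤o⇒n≤o M N (r q)))))
               (*-mono (0≤∣p∣ (t n)) (<⇒≤ 0<δ)
                 (<⇒≤ (hM m n (ℕₚ.m⊔n≤o⇒m≤o M N (r p)) (ℕₚ.m⊔n≤o⇒m≤o M N (r q))))
                 (hB n (ℕₚ.m⊔n≤o⇒n≤o M₁ N₁ (l q)))) ⟩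
        A * δ + δ * B
          ≡⟨ solve 3 (λ a b d → a :* d :+ d :* b := d :* (a :+ b)) refl A B δ ⟩
        δ * (A + B) ∎

  0<⊔ : ∀ q {δ} → 0ℚ < δ → 0ℚ < q ⊔ δ
  0<⊔ q {δ} 0<δ = <-≤-trans 0<δ (p≤q⊔p q δ)

  recip : (δ : ℚ) → 0ℚ < δ → ℚ → ℚ
  recip δ 0<δ q = (1/ (q ⊔ δ)) {{>-nonZero (0<⊔ q 0<δ)}}

  recip-pos : ∀ δ 0<δ q → 0ℚ < recip δ 0<δ q
  recip-pos δ 0<δ q = 0<1/ (0<⊔ q 0<δ)

  recip-inv : ∀ δ 0<δ q → δ ≤ q → q * recip δ 0<δ q ≡ 1ℚ
  recip-inv δ 0<δ q δ≤q =
    trans (cong (_* recip δ 0<δ q) (sym (p≥q⇒p⊔q≡p δ≤q)))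
      (*-inverseʳ (q ⊔ δ) {{>-nonZero (0<⊔ q 0<δ)}})

  recip-≤ : ∀ δ 0<δ q → recip δ 0<δ q ≤ (1/ δ) {{>-nonZero 0<δ}}
  recip-≤ δ 0<δ q = *-cancelʳ-≤-pos δ {{positive 0<δ}} (begin
    recip δ 0<δ q * δ
      ≤⟨ *-monoˡ-≤-nonNeg (recip δ 0<δ q) {{nonNegative (<⇒≤ (recip-pos δ 0<δ q))}} (p≤q⊔p q δ) ⟩
    recip δ 0<δ q * (q ⊔ δ)
      ≡⟨ *-inverseˡ (q ⊔ δ) {{>-nonZero (0<⊔ q 0<δ)}} ⟩
    1ℚ
      ≡⟨ *-inverseˡ δ {{>-nonZero 0<δ}} ⟨
    (1/ δ) {{>-nonZero 0<δ}} * δ ∎)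

  recip-cauchy : ∀ s δ (0<δ : 0ℚ < δ) N → (∀ n → N ℕ.≤ n → δ ≤ s n) →
    Cauchy s → Cauchy (λ n → recip δ 0<δ (s n))
  recip-cauchy s δ 0<δ N δ≤s cs =
    Cauchy-upto (λ n → recip δ 0<δ (s n)) (D * D) (0≤* 0≤D 0≤D) λ η 0<η →
      let (M , hM) = cs η 0<η
      in N ℕ.⊔ M , λ m n p q →
        let a = s m ; b = s n ; a' = r a ; b' = r b
            ea = recip-inv δ 0<δ a (δ≤s m (ℕₚ.m⊔n≤o⇒m≤o N M p))
            eb = recip-inv δ 0<δ b (δ≤s n (ℕₚ.m⊔n≤o⇒m≤o N M q))
        in begin
          dist a' b'
            ≡⟨ cong ℚ.∣_∣ (trans
                 (cong₂ _-_ (sym (trans (cong (a' *_) eb) (*-identityʳ a')))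
                            (sym (trans (cong (b' *_) ea) (*-identityʳ b'))))
                 (solve 4 (λ a b a' b' → a' :* (b :* b') :- b' :* (a :* a')
                    := (b :- a) :* (a' :* b')) refl a b a' b')) ⟩
          ℚ.∣ (b - a) * (a' * b') ∣
            ≡⟨ ∣p*q∣≡∣p∣*∣q∣ (b - a) (a' * b') ⟩
          dist b a * ℚ.∣ a' * b' ∣
            ≡⟨ cong (dist b a *_) (0≤p⇒∣p∣≡p (0≤* (0≤r a) (0≤r b))) ⟩
          dist b a * (a' * b')
            ≤⟨ *-mono (0≤* (0≤r a) (0≤r b)) (<⇒≤ 0<η)
                 (<⇒≤ (hM n m (ℕₚ.m⊔n≤o⇒n≤o N M q) (ℕₚ.m⊔n≤o⇒n≤o N M p)))
                 (*-mono (0≤r b) 0≤D (recip-≤ δ 0<δ a) (recip-≤ δ 0<δ b)) ⟩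
          η * (D * D) ∎
    where
    r = recip δ 0<δ
    D = (1/ δ) {{>-nonZero 0<δ}}
    0≤D = <⇒≤ (0<1/ 0<δ)
    0≤r = λ q → <⇒≤ (recip-pos δ 0<δ q)

  -- term q k = qᵏ / k!
  term : ℚ → ℕ → ℚ
  term q zero    = 1ℚ
  term q (suc k) = term q k * q * 1/1+ k

  -- expSum q n = Σ_{k<n} qᵏ / k!
  expSum : ℚ → ℕ → ℚ
  expSum q zero    = 0ℚ
  expSum q (suc k) = expSum q k + term q k

  module ExpBounds where
    0≤1/ι : ∀ k → 0ℚ ≤ 1/1+ k
    0≤1/ι k = <⇒≤ (positive⁻¹ (1/1+ k) {{1/pos⇒pos (ι (suc k)) {{ι-pos k}}}})

    0≤term : ∀ {B} → 0ℚ ≤ B → ∀ k → 0ℚ ≤ term B k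
    0≤term p zero    = 1≥0
    0≤term p (suc k) = 0≤* (0≤* (0≤term p k) p) (0≤1/ι k)

    0≤expSum : ∀ {B} → 0ℚ ≤ B → ∀ k → 0ℚ ≤ expSum B k
    0≤expSum p zero    = ≤-refl
    0≤expSum p (suc k) = 0≤+ (0≤expSum p k) (0≤term p k)

    ∣1/ι∣ : ∀ k → ℚ.∣ 1/1+ k ∣ ≡ 1/1+ k
    ∣1/ι∣ k = 0≤p⇒∣p∣≡p (0≤1/ι k)

    ∣term∣≤ : ∀ {a B} → 0ℚ ≤ B → ℚ.∣ a ∣ ≤ B → ∀ k → ℚ.∣ term a k ∣ ≤ term B k
    ∣term∣≤ 0≤B a≤B zero = ≤-refl
    ∣term∣≤ {a} {B} 0≤B a≤B (suc k) = begin
      ℚ.∣ term a k * a * 1/1+ k ∣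
        ≡⟨ ∣p*q∣≡∣p∣*∣q∣ (term a k * a) (1/1+ k) ⟩
      ℚ.∣ term a k * a ∣ * ℚ.∣ 1/1+ k ∣
        ≡⟨ cong₂ _*_ (∣p*q∣≡∣p∣*∣q∣ (term a k) a) (∣1/ι∣ k) ⟩
      ℚ.∣ term a k ∣ * ℚ.∣ a ∣ * 1/1+ k
        ≤⟨ *-monoʳ-≤-nonNeg (1/1+ k) {{nonNegative (0≤1/ι k)}}
             (*-mono (0≤∣p∣ a) (0≤term 0≤B k) (∣term∣≤ 0≤B a≤B k) a≤B) ⟩
      term B k * B * 1/1+ k ∎

    term-step : ∀ B k → term B (suc k) * ι (suc k) ≡ term B k * B
    term-step B k = trans (*-assoc (term B k * B) _ _)
      (trans (cong (λ z → term B k * B * z) (*-inverseˡ (ι (suc k)) {{ι-nonZero k}})) (*-identityʳ _))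

    term-lipschitz : ∀ {a b B} → 0ℚ ≤ B → ℚ.∣ a ∣ ≤ B → ℚ.∣ b ∣ ≤ B → ∀ k →
      dist (term a (suc k)) (term b (suc k)) ≤ dist a b * term B k
    term-lipschitz {a} {b} {B} 0≤B a≤B b≤B k = begin
      dist (ta * a * i) (tb * b * i)
        ≡⟨ cong ℚ.∣_∣ (solve 3 (λ x y i → x :* i :- y :* i := (x :- y) :* i)
             refl (ta * a) (tb * b) i) ⟩
      ℚ.∣ (ta * a - tb * b) * i ∣
        ≡⟨ trans (∣p*q∣≡∣p∣*∣q∣ (ta * a - tb * b) i)
             (cong (dist (ta * a) (tb * b) *_) (∣1/ι∣ k)) ⟩
      dist (ta * a) (tb * b) * i
        ≤⟨ *-monoʳ-≤-nonNeg i {{nonNegative (0≤1/ι k)}} (main k) ⟩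
      dist a b * (ι (suc k) * term B k) * i
        ≡⟨ solve 4 (λ d n t i → d :* (n :* t) :* i := d :* t :* (n :* i))
             refl (dist a b) (ι (suc k)) (term B k) i ⟩
      dist a b * term B k * (ι (suc k) * i)
        ≡⟨ cong (λ z → dist a b * term B k * z) (*-inverseʳ (ι (suc k)) {{ι-nonZero k}}) ⟩
      dist a b * term B k * 1ℚ
        ≡⟨ *-identityʳ _ ⟩
      dist a b * term B k ∎
      where
      i = 1/1+ k
      ta = term a k
      tb = term b k
      main : ∀ k → dist (term a k * a) (term b k * b) ≤ dist a b * (ι (suc k) * term B k)
      main zero = ≤-reflexive (trans
        (cong₂ dist (*-identityˡ a) (*-identityˡ b)) (sym (*-identityʳ (dist a b))))
      main (suc k) = begin
        dist (term a (suc k) * a) (term b (suc k) * b)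
          ≤⟨ dist-* (term a (suc k)) a (term b (suc k)) b ⟩
        ℚ.∣ term a (suc k) ∣ * dist a b + dist (term a (suc k)) (term b (suc k)) * ℚ.∣ b ∣
          ≤⟨ +-mono-≤
               (*-monoʳ-≤-nonNeg (dist a b) {{nonNegative (0≤∣p∣ (a - b))}}
                 (∣term∣≤ 0≤B a≤B (suc k)))
               (*-mono (0≤∣p∣ b) (0≤* (0≤∣p∣ (a - b)) (0≤term 0≤B k))
                 (term-lipschitz 0≤B a≤B b≤B k) b≤B) ⟩
        term B (suc k) * dist a b + dist a b * term B k * B
          ≡⟨ cong (λ z → term B (suc k) * dist a b + z)
               (trans (*-assoc (dist a b) (term B k) B)
                 (cong (dist a b *_) (sym (term-step B k)))) ⟩
        term B (suc k) * dist a b + dist a b * (term B (suc k) * ι (suc k))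
          ≡⟨ solve 3 (λ t d n → t :* d :+ d :* (t :* n) := d :* ((con 1ℚ :+ n) :* t))
               refl (term B (suc k)) (dist a b) (ι (suc k)) ⟩
        dist a b * ((1ℚ + ι (suc k)) * term B (suc k))
          ≡⟨ cong (λ n → dist a b * (n * term B (suc k))) (sym (ι-suc (suc k))) ⟩
        dist a b * (ι (suc (suc k)) * term B (suc k)) ∎

    expSum-lipschitz : ∀ {a b B} → 0ℚ ≤ B → ℚ.∣ a ∣ ≤ B → ℚ.∣ b ∣ ≤ B → ∀ n →
      dist (expSum a (suc n)) (expSum b (suc n)) ≤ dist a b * expSum B n
    expSum-lipschitz {a} {b} 0≤B a≤B b≤B zero = ≤-reflexive (sym (*-zeroʳ (dist a b)))
    expSum-lipschitz {a} {b} {B} 0≤B a≤B b≤B (suc n) = begin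
      dist (expSum a (suc n) + term a (suc n)) (expSum b (suc n) + term b (suc n))
        ≤⟨ dist-+ (expSum a (suc n)) _ (expSum b (suc n)) _ ⟩
      dist (expSum a (suc n)) (expSum b (suc n)) + dist (term a (suc n)) (term b (suc n))
        ≤⟨ +-mono-≤ (expSum-lipschitz 0≤B a≤B b≤B n) (term-lipschitz 0≤B a≤B b≤B n) ⟩
      dist a b * expSum B n + dist a b * term B n
        ≡⟨ *-distribˡ-+ (dist a b) _ _ ⟨
      dist a b * (expSum B n + term B n) ∎

    expSum-tail : ∀ {a B} → 0ℚ ≤ B → ℚ.∣ a ∣ ≤ B → ∀ n j →
      dist (expSum a (j ℕ.+ n)) (expSum a n) + expSum B n ≤ expSum B (j ℕ.+ n)
    expSum-tail {a} {B} 0≤B a≤B n zero = ≤-reflexive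
      (trans (cong (λ z → ℚ.∣ z ∣ + expSum B n) (+-inverseʳ (expSum a n)))
        (+-identityˡ _))
    expSum-tail {a} {B} 0≤B a≤B n (suc j) = begin
      dist (expSum a (j ℕ.+ n) + term a (j ℕ.+ n)) (expSum a n) + expSum B n
        ≡⟨ cong (λ z → ℚ.∣ z ∣ + expSum B n) (solve 3 (λ s t u →
             s :+ t :- u := (s :- u) :+ t) refl (expSum a (j ℕ.+ n)) _ (expSum a n)) ⟩
      ℚ.∣ (expSum a (j ℕ.+ n) - expSum a n) + term a (j ℕ.+ n) ∣ + expSum B n
        ≤⟨ +-monoˡ-≤ (expSum B n) (∣p+q∣≤∣p∣+∣q∣ (expSum a (j ℕ.+ n) - expSum a n) _) ⟩
      dist (expSum a (j ℕ.+ n)) (expSum a n) + ℚ.∣ term a (j ℕ.+ n) ∣ + expSum B n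
        ≡⟨ solve 3 (λ d t e → d :+ t :+ e := d :+ e :+ t) refl
             (dist (expSum a (j ℕ.+ n)) (expSum a n)) _ _ ⟩
      dist (expSum a (j ℕ.+ n)) (expSum a n) + expSum B n + ℚ.∣ term a (j ℕ.+ n) ∣
        ≤⟨ +-mono-≤ (expSum-tail 0≤B a≤B n j) (∣term∣≤ 0≤B a≤B (j ℕ.+ n)) ⟩
      expSum B (j ℕ.+ n) + term B (j ℕ.+ n) ∎

    module Tail (B : ℚ) (0≤B : 0ℚ ≤ B) (K : ℕ) (B+B≤K : B + B ≤ ι K) where

      halve : ∀ n → K ℕ.≤ n → term B (suc n) + term B (suc n) ≤ term B n
      halve n K≤n = *-cancelʳ-≤-pos (ι (suc n)) {{ι-pos n}} (begin
        (t' + t') * ι (suc n)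
          ≡⟨ *-distribʳ-+ (ι (suc n)) t' t' ⟩
        t' * ι (suc n) + t' * ι (suc n)
          ≡⟨ cong₂ _+_ (term-step B n) (term-step B n) ⟩
        t * B + t * B
          ≡⟨ *-distribˡ-+ t B B ⟨
        t * (B + B)
          ≤⟨ *-monoˡ-≤-nonNeg t {{nonNegative (0≤term 0≤B n)}}
               (≤-trans B+B≤K (ι-mono (ℕₚ.m≤n⇒m≤1+n K≤n))) ⟩
        t * ι (suc n) ∎)
        where
        t = term B n
        t' = term B (suc n)

      2t : ℕ → ℚ
      2t n = term B n + term B n

      tail : ∀ n → K ℕ.≤ n → ∀ j → expSum B (j ℕ.+ n) + 2t (j ℕ.+ n) ≤ expSum B n + 2t n
      tail n K≤n zero    = ≤-refl
      tail n K≤n (suc j) = ≤-trans (begin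
        (e + t) + 2t (suc m)  ≡⟨ +-assoc e t _ ⟩
        e + (t + 2t (suc m))
          ≤⟨ +-monoʳ-≤ e (+-monoʳ-≤ t (halve m (ℕₚ.≤-trans K≤n (ℕₚ.m≤n+m n j)))) ⟩
        e + 2t m ∎) (tail n K≤n j)
        where
        m = j ℕ.+ n
        e = expSum B m
        t = term B m

      expSum≤ : ∀ n → K ℕ.≤ n → ∀ j → expSum B (j ℕ.+ n) ≤ expSum B n + 2t n
      expSum≤ n K≤n j = ≤-trans
        (subst (_≤ expSum B (j ℕ.+ n) + 2t (j ℕ.+ n)) (+-identityʳ _)
          (+-monoʳ-≤ (expSum B (j ℕ.+ n)) (0≤+ (0≤term 0≤B (j ℕ.+ n)) (0≤term 0≤B (j ℕ.+ n)))))
        (tail n K≤n j)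

      decay : ∀ j → ι (suc j) * term B (j ℕ.+ K) ≤ term B K
      decay zero    = ≤-reflexive (*-identityˡ _)
      decay (suc j) = ≤-trans (begin
        ι (suc (suc j)) * t'
          ≡⟨ cong (_* t') (ι-suc (suc j)) ⟩
        (1ℚ + ι (suc j)) * t'
          ≤⟨ *-monoʳ-≤-nonNeg t' {{nonNegative (0≤term 0≤B (suc (j ℕ.+ K)))}}
               (+-monoˡ-≤ (ι (suc j)) (ι-mono {1} {suc j} (ℕ.s≤s ℕ.z≤n))) ⟩
        (ι (suc j) + ι (suc j)) * t'
          ≡⟨ solve 2 (λ n t → (n :+ n) :* t := n :* (t :+ t)) refl (ι (suc j)) t' ⟩
        ι (suc j) * (t' + t')
          ≤⟨ *-monoˡ-≤-nonNeg (ι (suc j)) {{nonNegative (0≤ι (suc j))}}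
               (halve (j ℕ.+ K) (ℕₚ.m≤n+m K j)) ⟩
        ι (suc j) * term B (j ℕ.+ K) ∎) (decay j)
        where t' = term B (suc j ℕ.+ K)

      small : ∀ δ → 0ℚ < δ → ∃ λ N → K ℕ.≤ N × (∀ n → N ℕ.≤ n → term B n ≤ δ)
      small δ 0<δ = J ℕ.+ K , ℕₚ.m≤n+m K J , λ n p →
        let (i , e) = ℕₚ.m≤n⇒∃[o]m+o≡n p
            j = i ℕ.+ J
            e' : j ℕ.+ K ≡ n
            e' = trans (ℕₚ.+-assoc i J K) (trans (ℕₚ.+-comm i (J ℕ.+ K)) e)
        in subst (λ m → term B m ≤ δ) e' (*-cancelˡ-≤-pos (ι (suc j)) {{ι-pos j}} (begin
             ι (suc j) * term B (j ℕ.+ K)  ≤⟨ decay j ⟩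
             term B K                      ≡⟨ divide 0<δ ⟨
             term B K * (1/ δ) {{>-nonZero 0<δ}} * δ
               ≤⟨ *-monoʳ-≤-nonNeg δ {{nonNegative (<⇒≤ 0<δ)}}
                    (≤-trans hJ (ι-mono (ℕₚ.m≤n⇒m≤1+n (ℕₚ.m≤n+m J i)))) ⟩
             ι (suc j) * δ ∎))
        where
        arch = ι≥ (term B K * (1/ δ) {{>-nonZero 0<δ}})
        J = proj₁ arch
        hJ = proj₂ arch

  open ExpBounds

  exp-cauchy : ∀ s → Cauchy s → Cauchy (λ n → expSum (s n) n)
  exp-cauchy s cs =
    Cauchy-upto (λ n → expSum (s n) n) (1ℚ + 1ℚ + C) (0≤+ (0≤+ 1≥0 1≥0) 0≤C) λ δ 0<δ →
      let (M , hM) = cs δ 0<δ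
          (N , K≤N , hN) = small δ 0<δ
          L = (N₀ ℕ.⊔ M) ℕ.⊔ suc N
          main : ∀ m n → L ℕ.≤ n → n ℕ.≤ m →
            dist (expSum (s m) m) (expSum (s n) n) ≤ δ * (1ℚ + 1ℚ + C)
          main m n p n≤m =
            let q = ℕₚ.≤-trans p n≤m
                l = λ {k} (p : L ℕ.≤ k) → ℕₚ.m⊔n≤o⇒m≤o (N₀ ℕ.⊔ M) (suc N) p
                sN≤n = ℕₚ.m⊔n≤o⇒n≤o (N₀ ℕ.⊔ M) (suc N) p
                N≤n = ℕₚ.≤-trans (ℕₚ.n≤1+n N) sN≤n
                K≤n = ℕₚ.≤-trans K≤N N≤n
                bm = hB m (ℕₚ.m⊔n≤o⇒m≤o N₀ M (l q))
                bn = hB n (ℕₚ.m⊔n≤o⇒m≤o N₀ M (l p))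
                d  = <⇒≤ (hM m n (ℕₚ.m⊔n≤o⇒n≤o N₀ M (l q)) (ℕₚ.m⊔n≤o⇒n≤o N₀ M (l p)))
            in begin
              dist (expSum (s m) m) (expSum (s n) n)
                ≤⟨ dist-tri (expSum (s m) m) (expSum (s m) n) (expSum (s n) n) ⟩
              dist (expSum (s m) m) (expSum (s m) n) + dist (expSum (s m) n) (expSum (s n) n)
                ≤⟨ +-mono-≤
                     (tail-bound (s m) bm n m K≤n n≤m)
                     (lip-bound (s m) (s n) bm bn n K≤n) ⟩
              2t n + dist (s m) (s n) * C
                ≤⟨ +-mono-≤ (+-mono-≤ (hN n N≤n) (hN n N≤n))
                     (*-monoʳ-≤-nonNeg C {{nonNegative 0≤C}} d) ⟩
              δ + δ + δ * C
                ≡⟨ solve 2 (λ d c → d :+ d :+ d :* c := d :* (con 1ℚ :+ con 1ℚ :+ c))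
                     refl δ C ⟩
              δ * (1ℚ + 1ℚ + C) ∎
      in L , λ m n p q → [ (λ n≤m → main m n q n≤m)
                         , (λ m≤n → subst (_≤ δ * (1ℚ + 1ℚ + C))
                              (dist-sym (expSum (s n) n) (expSum (s m) m)) (main n m p m≤n))
                         ]′ (ℕₚ.≤-total n m)
    where
    bd = Cauchy⇒bounded s cs
    B = proj₁ bd
    0≤B = proj₁ (proj₂ bd)
    N₀ = proj₁ (proj₂ (proj₂ bd))
    hB = proj₂ (proj₂ (proj₂ bd))
    K = proj₁ (ι≥ (B + B))
    open Tail B 0≤B K (proj₂ (ι≥ (B + B)))
    C = expSum B K + 2t K
    0≤C = 0≤+ (0≤expSum 0≤B K) (0≤+ (0≤term 0≤B K) (0≤term 0≤B K))

    tail-bound : ∀ a → ℚ.∣ a ∣ ≤ B → ∀ n m → K ℕ.≤ n → n ℕ.≤ m →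
      dist (expSum a m) (expSum a n) ≤ 2t n
    tail-bound a a≤B n m K≤n n≤m =
      let (j , e) = ℕₚ.m≤n⇒∃[o]m+o≡n n≤m
          e' = trans (ℕₚ.+-comm j n) e
      in subst (λ m → dist (expSum a m) (expSum a n) ≤ 2t n) e'
        (cancel (begin
          dist (expSum a (j ℕ.+ n)) (expSum a n) + expSum B n ≤⟨ expSum-tail 0≤B a≤B n j ⟩
          expSum B (j ℕ.+ n)      ≤⟨ expSum≤ n K≤n j ⟩
          expSum B n + 2t n       ≡⟨ +-comm (expSum B n) (2t n) ⟩
          2t n + expSum B n ∎))
      where
      cancel : ∀ {x y z} → x + z ≤ y + z → x ≤ y
      cancel {x} {y} {z} h = subst₂ _≤_ (lem x) (lem y) (+-monoˡ-≤ (- z) h)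
        where
        lem : ∀ w → w + z - z ≡ w
        lem w = solve 2 (λ w z → w :+ z :- z := w) refl w z

    lip-bound : ∀ a b → ℚ.∣ a ∣ ≤ B → ℚ.∣ b ∣ ≤ B → ∀ n → K ℕ.≤ n →
      dist (expSum a n) (expSum b n) ≤ dist a b * C
    lip-bound a b a≤B b≤B zero K≤n = 0≤* (0≤∣p∣ (a - b)) 0≤C
    lip-bound a b a≤B b≤B (suc n) K≤n = ≤-trans (expSum-lipschitz 0≤B a≤B b≤B n)
      (*-monoˡ-≤-nonNeg (dist a b) {{nonNegative (0≤∣p∣ (a - b))}} expSum≤C)
      where
      expSum≤C : expSum B n ≤ C
      expSum≤C =
        let (j , e) = ℕₚ.m≤n⇒∃[o]m+o≡n K≤n
            e' = trans (ℕₚ.+-comm j K) e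
        in ≤-trans (subst (_≤ expSum B n + term B n) (+-identityʳ _)
                     (+-monoʳ-≤ (expSum B n) (0≤term 0≤B n)))
             (subst (λ k → expSum B k ≤ C) e' (expSum≤ K ℕₚ.≤-refl j))

open Rat using (ι; Cauchy; expSum)

-- A real is a Cauchy sequence of rationals; equality of reals is _≈_, not _≡_.

record ℝ : Set where
  constructor mkℝ
  field
    seq    : ℕ → ℚ
    cauchy : Cauchy seq
open ℝ public

infix  4 _≈_ _<_ _≤_
infixl 6 _+_ _-_
infixl 7 _*_
infix  8 -_

_≈_ : ℝ → ℝ → Set
x ≈ y = ∀ δ → 0ℚ ℚ.< δ → ∃ λ N → ∀ n → N ℕ.≤ n → ℚ.∣ seq x n ℚ.- seq y n ∣ ℚ.< δ

_<_ : ℝ → ℝ → Set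
x < y = ∃ λ δ → 0ℚ ℚ.< δ × ∃ λ N → ∀ n → N ℕ.≤ n → seq x n ℚ.+ δ ℚ.≤ seq y n

_≤_ : ℝ → ℝ → Set
x ≤ y = ¬ (y < x)

fromℚ : ℚ → ℝ
fromℚ q = mkℝ (λ _ → q) (Rat.const-cauchy q)

fromℕ : ℕ → ℝ
fromℕ n = fromℚ (ι n)

0ℝ 1ℝ : ℝ
0ℝ = fromℚ 0ℚ
1ℝ = fromℚ 1ℚ

_+_ : ℝ → ℝ → ℝ
x + y = mkℝ (λ n → seq x n ℚ.+ seq y n) (Rat.+-cauchy (seq x) (seq y) (cauchy x) (cauchy y))

-_ : ℝ → ℝ
- x = mkℝ (λ n → ℚ.- seq x n) (Rat.neg-cauchy (seq x) (cauchy x))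

_-_ : ℝ → ℝ → ℝ
x - y = x + (- y)

_*_ : ℝ → ℝ → ℝ
x * y = mkℝ (λ n → seq x n ℚ.* seq y n) (Rat.*-cauchy (seq x) (seq y) (cauchy x) (cauchy y))

0<⇒bounded-below : ∀ {x} ((δ , _ , N , _) : 0ℝ < x) → ∀ n → N ℕ.≤ n → δ ℚ.≤ seq x n
0<⇒bounded-below (δ , _ , _ , h) n N≤n =
  subst (ℚ._≤ _) (ℚₚ.+-identityˡ δ) (h n N≤n)

-- The sequence is n ↦ 1 / (xₙ ⊔ δ), where xₙ ≥ δ > 0 eventually; up to _≈_ it
-- does not depend on δ.
inverse : (x : ℝ) → 0ℝ < x → ℝ
inverse x 0<x@(δ , 0<δ , N , _) = mkℝ (λ n → Rat.recip δ 0<δ (seq x n))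
  (Rat.recip-cauchy (seq x) δ 0<δ N (0<⇒bounded-below {x} 0<x) (cauchy x))

1≤⇒0< : ∀ {x} → 1ℝ ≤ x → 0ℝ < x
1≤⇒0< {x} 1≤x = ¼ , 0<¼ , N , λ n N≤n → begin
  0ℚ ℚ.+ ¼           ≡⟨ trans (ℚₚ.+-identityˡ ¼) ¼≡½-¼ ⟩
  ½ ℚ.- ¼            ≤⟨ ℚₚ.+-monoˡ-≤ (ℚ.- ¼) ½≤xN ⟩
  seq x N ℚ.- ¼      ≤⟨ ℚₚ.+-monoˡ-≤ (ℚ.- ¼) (near N n ℕₚ.≤-refl N≤n) ⟩
  seq x n ℚ.+ ¼ ℚ.- ¼
    ≡⟨ solve 2 (λ a b → a :+ b :- b := a) refl (seq x n) ¼ ⟩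
  seq x n ∎
  where
  open ℚₚ.≤-Reasoning
  open +-*-Solver
  ¼ = + 1 ℚ./ 4
  0<¼ = ℚₚ.positive⁻¹ ¼
  ¼≡½-¼ : ¼ ≡ ½ ℚ.- ¼
  ¼≡½-¼ = refl
  N = proj₁ (cauchy x ¼ 0<¼)
  near : ∀ m n → N ℕ.≤ m → N ℕ.≤ n → seq x m ℚ.≤ seq x n ℚ.+ ¼
  near m n p q = begin
    seq x m
      ≡⟨ solve 2 (λ a b → a := b :+ (a :- b)) refl (seq x m) (seq x n) ⟩
    seq x n ℚ.+ (seq x m ℚ.- seq x n)
      ≤⟨ ℚₚ.+-monoʳ-≤ (seq x n) (ℚₚ.≤-trans (Rat.p≤∣p∣ (seq x m ℚ.- seq x n))
           (ℚₚ.<⇒≤ (proj₂ (cauchy x ¼ 0<¼) m n p q))) ⟩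
    seq x n ℚ.+ ¼ ∎
  ½≤xN : ½ ℚ.≤ seq x N
  ½≤xN = ℚₚ.≮⇒≥ λ xN<½ → 1≤x (¼ , 0<¼ , N , λ n N≤n → begin
    seq x n ℚ.+ ¼          ≤⟨ ℚₚ.+-monoˡ-≤ ¼ (near n N N≤n ℕₚ.≤-refl) ⟩
    seq x N ℚ.+ ¼ ℚ.+ ¼    ≤⟨ ℚₚ.+-monoˡ-≤ ¼ (ℚₚ.+-monoˡ-≤ ¼ (ℚₚ.<⇒≤ xN<½)) ⟩
    ½ ℚ.+ ¼ ℚ.+ ¼          ≡⟨⟩
    1ℚ ∎)

-- eˣ = Σ xᵏ / k!, along the diagonal: the n-th rational approximation is the
-- n-th partial sum of the series at the n-th approximation of x.
exp : ℝ → ℝ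
exp x = mkℝ (λ n → expSum (seq x n) n) (Rat.exp-cauchy (seq x) (cauchy x))

IsLog : ℝ → ℝ → Set
IsLog x ℓ = exp ℓ ≈ x

∑ : (ℕ → ℝ) → ℕ → ℝ
∑ f zero    = 0ℝ
∑ f (suc n) = ∑ f n + f n

infix 4 _⟶_

_⟶_ : (ℕ → ℝ) → ℝ → Set
s ⟶ l = ∀ δ → 0ℝ < δ → ∃ λ N → ∀ n → N ℕ.≤ n → (l - δ < s n) × (s n < l + δ)

record IsσAlgebra {Ω : Set} (Measurable : Pred Ω 0ℓ → Set₁) : Set₁ where
  field
    resp-≐ : ∀ {A B} → A ≐ B → Measurable A → Measurable B
    full   : Measurable U
    compl  : ∀ {A} → Measurable A → Measurable (∁ A)
    union  : ∀ {A : ℕ → Pred Ω 0ℓ} → (∀ i → Measurable (A i)) → Measurable (⋃ ℕ A)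

  empty : Measurable ∅
  empty = resp-≐ ((λ ¬u → ¬u tt) , (λ ())) (compl full)

-- Classically `monotone` follows from the other laws; it is a separate field because
-- constructively B need not equal A ∪ (B ∖ A).
record ProbabilitySpace : Set₂ where
  field
    Ω           : Set
    Measurable  : Pred Ω 0ℓ → Set₁
    isσAlgebra  : IsσAlgebra Measurable
  open IsσAlgebra isσAlgebra public
  field
    P           : ∀ {A} → Measurable A → ℝ
    nonneg      : ∀ {A} (mA : Measurable A) → 0ℝ ≤ P mA
    monotone    : ∀ {A B} (mA : Measurable A) (mB : Measurable B) → A ⊆ B → P mA ≤ P mB
    P-full      : P full ≈ 1ℝ
    P-empty     : P empty ≈ 0ℝ
    additive    : ∀ {A : ℕ → Pred Ω 0ℓ} (mA : ∀ i → Measurable (A i)) →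
                  (∀ i j → i ≢ j → ∀ ω → A i ω → ¬ A j ω) →
                  ∑ (λ i → P (mA i)) ⟶ P (union mA)

-- The Borel σ-algebra on ℝⁿ generated by the coordinate open rays
data Borel {n : ℕ} : Pred (Fin n → ℝ) 0ℓ → Set₁ where
  below  : ∀ v a → Borel (λ y → y v < a)
  above  : ∀ v a → Borel (λ y → a < y v)
  resp-≐ : ∀ {A B} → A ≐ B → Borel A → Borel B
  full   : Borel U
  compl  : ∀ {A} → Borel A → Borel (∁ A)
  union  : ∀ {A : ℕ → Pred (Fin n → ℝ) 0ℓ} → (∀ i → Borel (A i)) → Borel (⋃ ℕ A)

record RandomVector (n : ℕ) : Set₂ where
  field
    space : ProbabilitySpace
  open ProbabilitySpace space
  field
    value      : Ω → Fin n → ℝ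
    measurable : ∀ {Y} → Borel Y → Measurable (λ ω → Y (value ω))

Pr[_∈_] : ∀ {n} → RandomVector n → {Y : Pred (Fin n → ℝ) 0ℓ} → Borel Y → ℝ
Pr[ X ∈ bY ] = ProbabilitySpace.P (RandomVector.space X) (RandomVector.measurable X bY)

record Graph (n : ℕ) : Set where
  field
    adj        : Fin n → Fin n → Bool
    adj-sym    : ∀ u w → adj u w ≡ adj w u
    adj-irrefl : ∀ u → adj u u ≡ false
open Graph public

-- A subgraph is given by any vertex set and any set of edges of G inside it; it need
-- not be induced.
record Subgraph {n} (G : Graph n) : Set where
  field
    verts    : Subset n
    edge     : Fin n → Fin n → Bool
    edge-sym : ∀ u w → edge u w ≡ edge w u
    edge-adj : ∀ {u w} → T (edge u w) → T (adj G u w)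
    edge-end : ∀ {u w} → T (edge u w) → u ∈ verts

  deg : Fin n → ℕ
  deg u = ∣ tabulate (edge u) ∣

InCore : ∀ {n} → Graph n → Fin n → ℕ → Set
InCore G v k = Σ (Subgraph G) λ H → let open Subgraph H in
  v ∈ verts × (∀ u → u ∈ verts → k ℕ.≤ deg u)

IsCoreness : ∀ {n} → Graph n → Fin n → ℕ → Set
IsCoreness G v k = InCore G v k × (∀ j → InCore G v j → j ℕ.≤ k)

module _ {n} (G : Graph n) where
  open Equivalence using (to; from)

  private
    induced : Subset n → Subgraph G
    induced S = record
      { verts    = S
      ; edge     = λ u w → (lookup S u ∧ lookup S w) ∧ adj G u w
      ; edge-sym = λ u w → cong₂ _∧_ (∧-comm (lookup S u) (lookup S w)) (adj-sym G u w)
      ; edge-adj = λ {u} {w} t → proj₂ (to (T-∧ {lookup S u ∧ lookup S w}) t)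
      ; edge-end = λ {u} {w} t → lookup⇒[]= u S (T⇒≡
          (proj₁ (to (T-∧ {lookup S u}) (proj₁ (to (T-∧ {lookup S u ∧ lookup S w}) t)))))
      }
      where
      T⇒≡ : ∀ {b} → T b → b ≡ true
      T⇒≡ {true} _ = refl

    open Subgraph

    ∈⇒T : ∀ (f : Fin n → Bool) {u} → u ∈ tabulate f → T (f u)
    ∈⇒T f {u} p = subst T (sym (trans (sym (lookup∘tabulate f u)) ([]=⇒lookup p))) tt

    T⇒∈ : ∀ (f : Fin n → Bool) {u} → T (f u) → u ∈ tabulate f
    T⇒∈ f {u} t = lookup⇒[]= u _ (trans (lookup∘tabulate f u) (eq (f u) t))
      where
      eq : ∀ b → T b → b ≡ true
      eq true _ = refl

    deg-induced : ∀ (H : Subgraph G) u → deg H u ℕ.≤ deg (induced (verts H)) u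
    deg-induced H u = p⊆q⇒∣p∣≤∣q∣ λ {w} w∈ →
      let t = ∈⇒T (edge H u) w∈
          ∈S : ∀ {x} → x ∈ verts H → T (lookup (verts H) x)
          ∈S p = subst T (sym ([]=⇒lookup p)) tt
      in T⇒∈ (edge (induced (verts H)) u) (from T-∧
           ( from T-∧ (∈S (edge-end H t)
                      , ∈S (edge-end H (subst T (edge-sym H u w) t)))
           , edge-adj H t))

    inCore? : ∀ v k → Dec (InCore G v k)
    inCore? v k = Dec.map′
      (λ (S , v∈S , h) → induced S , v∈S , h)
      (λ (H , v∈H , h) → verts H , v∈H , λ u u∈H →
        ℕₚ.≤-trans (h u u∈H) (deg-induced H u))
      (anySubset? λ S → (v ∈? S) Dec.×-dec
        all? λ u → (u ∈? S) Dec.→-dec (k ℕₚ.≤? deg (induced S) u))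

    search : ∀ v b → (∀ j → InCore G v j → j ℕ.≤ b) → ∃ (IsCoreness G v)
    search v b bound with inCore? v b
    ... | yes c = b , c , bound
    search v zero    bound | no ¬c = ⊥-elim (¬c (induced ⊤ , ∈⊤ , λ _ _ → ℕ.z≤n))
    search v (suc b) bound | no ¬c = search v b λ j c →
      ℕ.s≤s⁻¹ (ℕₚ.≤∧≢⇒< (bound j c) λ { refl → ¬c c })

    coreness-exists : ∀ v → ∃ (IsCoreness G v)
    coreness-exists v = search v n λ j (H , v∈H , h) →
      ℕₚ.≤-trans (h v v∈H) (∣p∣≤n (tabulate (edge H v)))

  coreness : Fin n → ℕ
  coreness v = proj₁ (coreness-exists v)

  coreness-correct : ∀ v → IsCoreness G v (coreness v)
  coreness-correct v = proj₂ (coreness-exists v)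

-- Any two pairs on which the graphs disagree are the same unordered pair.
DifferInAtMostOneEdge : ∀ {n} → Graph n → Graph n → Set
DifferInAtMostOneEdge G G' = ∀ a b c d →
  adj G a b ≢ adj G' a b → adj G c d ≢ adj G' c d →
  (a ≡ c × b ≡ d) ⊎ (a ≡ d × b ≡ c)

Mechanism : ℕ → Set₂
Mechanism n = Graph n → RandomVector n

EdgeDP : ∀ {n} → ℝ → Mechanism n → Set₁
EdgeDP ε M = ∀ G G' → DifferInAtMostOneEdge G G' →
  ∀ {Y} (bY : Borel Y) → Pr[ M G ∈ bY ] ≤ exp ε * Pr[ M G' ∈ bY ]

Between : ∀ {n} (l u : Fin n → ℝ) → Pred (Fin n → ℝ) 0ℓ
Between l u y = ∀ v → (l v ≤ y v) × (y v ≤ u v)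

∅-borel : ∀ {n} → Borel {n} ∅
∅-borel = resp-≐ ((λ ¬u → ¬u tt) , (λ ())) (compl full)

∪-borel : ∀ {n} {A B : Pred (Fin n → ℝ) 0ℓ} → Borel A → Borel B → Borel (A ∪ B)
∪-borel {n} {A} {B} bA bB = resp-≐ (fwd , bwd) (union {A = F} λ { zero → bA ; (suc _) → bB })
  where
  F : ℕ → Pred (Fin n → ℝ) 0ℓ
  F zero    = A
  F (suc _) = B
  fwd : ⋃ ℕ F ⊆ A ∪ B
  fwd (zero  , a) = inj₁ a
  fwd (suc _ , b) = inj₂ b
  bwd : A ∪ B ⊆ ⋃ ℕ F
  bwd (inj₁ a) = 0 , a
  bwd (inj₂ b) = 1 , b

⋃Fin-borel : ∀ {n m} {A : Fin m → Pred (Fin n → ℝ) 0ℓ} →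
  (∀ i → Borel (A i)) → Borel (⋃ (Fin m) A)
⋃Fin-borel {n} {m} {A} bA = resp-≐
  ( (λ (_ , i , _ , a) → i , a) , (λ (i , a) → toℕ i , i , refl , a) )
  (union λ k → at k (k ℕₚ.<? m))
  where
  at : ∀ k → Dec (k ℕ.< m) → Borel (λ y → Σ (Fin m) λ i → toℕ i ≡ k × A i y)
  at k (yes k<m) = resp-≐
    ( (λ a → fromℕ< k<m , toℕ-fromℕ< k<m , a)
    , (λ { (i , refl , a) → subst (λ j → A j _) (sym (fromℕ<-toℕ i k<m)) a }) )
    (bA (fromℕ< k<m))
  at k (no k≮m) = resp-≐ ( (λ ()) , (λ { (i , refl , _) → ⊥-elim (k≮m (toℕ<n i)) })) ∅-borel

Between-borel : ∀ {n} (l u : Fin n → ℝ) → Borel (Between l u)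
Between-borel l u = resp-≐
  ( (λ h v → (λ p → h (v , inj₁ p)) , (λ p → h (v , inj₂ p)))
  , (λ { h (v , inj₁ p) → proj₁ (h v) p ; h (v , inj₂ p) → proj₂ (h v) p }) )
  (compl (⋃Fin-borel λ v → ∪-borel (below v (l v)) (above v (u v))))

Accurate : ∀ {n} (γ : ℝ) → 0ℝ < γ → (α p : ℝ) → Mechanism n → Set
Accurate γ 0<γ α p M = ∀ G →
  p ≤ Pr[ M G ∈ Between-borel (λ v → inverse γ 0<γ * fromℕ (coreness G v) - α)
                              (λ v → γ * fromℕ (coreness G v) + α) ]

{-# OPTIONS --safe #-}

-- Let K be the complete bipartite graph with sides of size s, where 2s ≤ n, together with
-- n − 2s isolated vertices. Joining an isolated vertex t to one side of K takes s
-- edges and raises the coreness of t from 0 to s, the other isolated vertices keeping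
-- coreness 0. If 2α < s / γ, then the accurate outputs on these n − 2s graphs form
-- disjoint events, and by privacy each has probability at least p e^(-ε(s+1)) on K.
-- Hence (n − 2s) p ≤ E^(s+1) for any E ≥ e^ε. If α < c γ⁻¹ log (np), one may take s
-- close to 2c log (np); for c small this makes E^(s+1) smaller than np / 2, while
-- n − 2s ≥ n / 2.
module Submission where

-- Rational sequences, comparison of their limits, and growth of the exponential series.

module Sequences where

  import Defs
  open Defs.Rat
  open import Data.Empty using (⊥)
  open import Data.Nat as ℕ using (ℕ; zero; suc)
  import Data.Nat.Properties as ℕₚ
  open import Data.Product using (∃; _×_; _,_)
  open import Data.Rational hiding (∣_∣)
  import Data.Rational as ℚ
  open import Data.Rational.Properties
  open import Data.Rational.Solver using (module +-*-Solver)
  open import Relation.Nullary using (¬_; yes; no)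
  open import Relation.Binary.PropositionalEquality
  open ≤-Reasoning
  open +-*-Solver

  -- Reduces an inequality to a ring identity for the solver and the nonnegativity of an explicit
  -- difference.
  by-difference : ∀ {a b} d → b - a ≡ d → 0ℚ ≤ d → a ≤ b
  by-difference {a} {b} d e 0≤d = begin
    a            ≡⟨ +-identityʳ a ⟨
    a + 0ℚ       ≤⟨ +-monoʳ-≤ a (subst (0ℚ ≤_) (sym e) 0≤d) ⟩
    a + (b - a)  ≡⟨ solve 2 (λ a b → a :+ (b :- a) := b) refl a b ⟩
    b ∎

  0≤-difference : ∀ {p q} → p ≤ q → 0ℚ ≤ q - p
  0≤-difference {p} {q} p≤q = subst (_≤ q - p) (+-inverseʳ p) (+-monoˡ-≤ (- p) p≤q)

  ≤-chain : ∀ c {a b x y} → a ≤ b + x → b ≤ c + y → a ≤ c + (y + x)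
  ≤-chain c {x = x} {y} p q =
    ≤-trans p (≤-trans (+-monoˡ-≤ x q) (≤-reflexive (+-assoc c y x)))

  dist⇒≤ : ∀ a b {δ} → dist a b < δ → a ≤ b + δ
  dist⇒≤ a b {δ} d = begin
    a            ≡⟨ solve 2 (λ a b → a := b :+ (a :- b)) refl a b ⟩
    b + (a - b)  ≤⟨ +-monoʳ-≤ b (≤-trans (p≤∣p∣ (a - b)) (<⇒≤ d)) ⟩
    b + δ ∎

  <⇒≱ : ∀ {p q} → p < q → ¬ (q ≤ p)
  <⇒≱ p<q q≤p = <-irrefl refl (<-≤-trans p<q q≤p)

  ½*< : ∀ {δ} → 0ℚ < δ → δ * ½ < δ
  ½*< {δ} 0<δ = subst₂ _<_ (+-identityʳ (δ * ½)) (½+½ δ) (+-monoʳ-< (δ * ½) (0<½* 0<δ))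

  ι-+ : ∀ m n → ι (m ℕ.+ n) ≡ ι m + ι n
  ι-+ zero    n = sym (+-identityˡ (ι n))
  ι-+ (suc m) n = trans (ι-suc (m ℕ.+ n)) (trans (cong (1ℚ +_) (ι-+ m n))
    (trans (sym (+-assoc 1ℚ (ι m) (ι n))) (cong (_+ ι n) (sym (ι-suc m)))))

  ι-* : ∀ m n → ι (m ℕ.* n) ≡ ι m * ι n
  ι-* zero    n = sym (*-zeroˡ (ι n))
  ι-* (suc m) n = trans (ι-+ n (m ℕ.* n)) (trans (cong (ι n +_) (ι-* m n))
    (trans (solve 2 (λ m n → n :+ m :* n := (con 1ℚ :+ m) :* n) refl (ι m) (ι n))
      (cong (_* ι n) (sym (ι-suc m)))))

  0<ι : ∀ n .{{_ : ℕ.NonZero n}} → 0ℚ < ι n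
  0<ι (suc n) = positive⁻¹ (ι (suc n)) {{ι-pos n}}

  Eventually : (ℕ → Set) → Set
  Eventually P = ∃ λ N → ∀ n → N ℕ.≤ n → P n

  ev-map : ∀ {P Q : ℕ → Set} → (∀ {n} → P n → Q n) → Eventually P → Eventually Q
  ev-map f (N , h) = N , λ n N≤n → f (h n N≤n)

  infixr 4 _⊗_

  _⊗_ : ∀ {P Q : ℕ → Set} → Eventually P → Eventually Q → Eventually (λ n → P n × Q n)
  (M , f) ⊗ (N , g) = M ℕ.⊔ N , λ n p →
    f n (ℕₚ.m⊔n≤o⇒m≤o M N p) , g n (ℕₚ.m⊔n≤o⇒n≤o M N p)

  ev-absurd : Eventually (λ _ → ⊥) → ⊥
  ev-absurd (N , h) = h N ℕₚ.≤-refl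

  infix 4 _≲_ _≪_

  -- For Cauchy sequences, s ≲ t and s ≪ t are ≤ and < between the limits.
  record _≲_ (s t : ℕ → ℚ) : Set where
    constructor lim≤
    field within : ∀ δ → 0ℚ < δ → Eventually (λ n → s n ≤ t n + δ)
  open _≲_

  _≪_ : (s t : ℕ → ℚ) → Set
  s ≪ t = ∃ λ δ → 0ℚ < δ × Eventually (λ n → s n + δ ≤ t n)

  eventually⇒≲ : ∀ {s t} → Eventually (λ n → s n ≤ t n) → s ≲ t
  eventually⇒≲ {s} {t} ev = lim≤ λ δ 0<δ → ev-map
    (λ {n} p → ≤-trans p
      (subst (_≤ t n + δ) (+-identityʳ (t n)) (+-monoʳ-≤ (t n) (<⇒≤ 0<δ)))) ev

  ≡⇒≲ : ∀ {s t} → (∀ n → s n ≡ t n) → s ≲ t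
  ≡⇒≲ e = eventually⇒≲ (0 , λ n _ → ≤-reflexive (e n))

  ≲-refl : ∀ s → s ≲ s
  ≲-refl s = ≡⇒≲ λ _ → refl

  ≲-trans : ∀ {s t u} → s ≲ t → t ≲ u → s ≲ u
  ≲-trans {s} {t} {u} (lim≤ f) (lim≤ g) = lim≤ λ δ 0<δ → ev-map
    (λ {n} (p , q) → subst (λ z → s n ≤ u n + z) (½+½ δ) (≤-chain (u n) p q))
    (f (δ * ½) (0<½* 0<δ) ⊗ g (δ * ½) (0<½* 0<δ))

  ≲-+ : ∀ {s t s' t'} → s ≲ t → s' ≲ t' → (λ n → s n + s' n) ≲ (λ n → t n + t' n)
  ≲-+ {s} {t} {s'} {t'} (lim≤ f) (lim≤ g) = lim≤ λ δ 0<δ → ev-map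
    (λ {n} (p , q) → ≤-trans (+-mono-≤ p q) (≤-reflexive
      (trans (solve 3 (λ a b d → (a :+ d) :+ (b :+ d) := (a :+ b) :+ (d :+ d)) refl
               (t n) (t' n) (δ * ½))
             (cong (t n + t' n +_) (½+½ δ)))))
    (f (δ * ½) (0<½* 0<δ) ⊗ g (δ * ½) (0<½* 0<δ))

  ≲-* : ∀ {s t} q → 0ℚ ≤ q → s ≲ t → (λ n → q * s n) ≲ (λ n → q * t n)
  ≲-* {s} {t} q 0≤q (lim≤ f) = lim≤ λ δ 0<δ →
    let 0<q+1 = 0<+1 0≤q
        -- Dividing by q + 1 rather than q covers q = 0.
        η = δ * (1/ (q + 1ℚ)) {{>-nonZero 0<q+1}}
        0<η = 0<* 0<δ (0<1/ 0<q+1)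
    in ev-map (λ {n} p → begin
         q * s n          ≤⟨ *-monoˡ-≤-nonNeg q {{nonNegative 0≤q}} p ⟩
         q * (t n + η)    ≤⟨ by-difference η (solve 3 (λ q t e →
                               q :* t :+ e :* (q :+ con 1ℚ) :- q :* (t :+ e) := e)
                               refl q (t n) η) (<⇒≤ 0<η) ⟩
         q * t n + η * (q + 1ℚ)  ≡⟨ cong (q * t n +_) (divide 0<q+1) ⟩
         q * t n + δ ∎)
       (f η 0<η)

  -- Single terms of y may be negative although the limit is not, so y is shifted by η = δ / 2B:
  -- then B y + δ - e y = (B - e)(y + η) + (B + e) η, where every factor is nonnegative.
  ≲-*-bounded : ∀ {e y : ℕ → ℚ} B → 0ℚ < B → Eventually (λ n → ℚ.∣ e n ∣ ≤ B) →
    (λ _ → 0ℚ) ≲ y → (λ n → e n * y n) ≲ (λ n → B * y n)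
  ≲-*-bounded {e} {y} B 0<B ∣e∣≤B (lim≤ 0≲y) = lim≤ λ δ 0<δ →
    let 0<2B = +-mono-< 0<B 0<B
        η = δ * (1/ (B + B)) {{>-nonZero 0<2B}}
        0<η = 0<* 0<δ (0<1/ 0<2B)
    in ev-map {λ n → ℚ.∣ e n ∣ ≤ B × 0ℚ ≤ y n + η} (λ {n} (b , p) → by-difference
         ((B - e n) * (y n + η) + (B - (- e n)) * η)
         (trans (cong (λ z → B * y n + z - e n * y n) (sym (divide 0<2B)))
           (solve 4 (λ B e y h → B :* y :+ h :* (B :+ B) :- e :* y :=
             (B :- e) :* (y :+ h) :+ (B :- :- e) :* h) refl B (e n) (y n) η))
         (0≤+ (0≤* (0≤-difference (≤-trans (p≤∣p∣ (e n)) b)) p)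
              (0≤* (0≤-difference (≤-trans (p≤∣p∣ (- e n)) (subst (_≤ B) (sym (∣-p∣≡∣p∣ (e n))) b)))
                   (<⇒≤ 0<η))))
       (∣e∣≤B ⊗ 0≲y η 0<η)

  ≲⇒≯ : ∀ {s t} → s ≲ t → t ≪ s → ⊥
  ≲⇒≯ {s} {t} (lim≤ f) (δ , 0<δ , ev) = ev-absurd (ev-map
    (λ {n} (p , q) → <⇒≱ (+-monoʳ-< (t n) (½*< 0<δ)) (≤-trans q p))
    (f (δ * ½) (0<½* 0<δ) ⊗ ev))

  -- The order of rationals is decidable, so it is enough to refute t n + δ < s n at one late index.
  -- The Cauchy property would carry such a gap to all later indices with at least η = δ / 8 left of
  -- it, giving t ≪ s.
  ≯⇒≲ : ∀ {s t} → Cauchy s → Cauchy t → ¬ (t ≪ s) → s ≲ t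
  ≯⇒≲ {s} {t} cs ct t≮s = lim≤ λ δ 0<δ →
    let η = δ * ½ * ½ * ½
        0<η = 0<½* (0<½* (0<½* 0<δ))
        (M , hs) = cs η 0<η
        (N , ht) = ct η 0<η
        K = M ℕ.⊔ N
        M≤ = λ {n} (p : K ℕ.≤ n) → ℕₚ.m⊔n≤o⇒m≤o M N p
        N≤ = λ {n} (p : K ℕ.≤ n) → ℕₚ.m⊔n≤o⇒n≤o M N p
    in K , λ n K≤n → ≮⇒≥ λ t+δ<s → t≮s
      ( η , 0<η , K , λ m K≤m → begin
          t m + η
            ≤⟨ +-monoˡ-≤ η (dist⇒≤ (t m) (t n) (ht m n (N≤ K≤m) (N≤ K≤n))) ⟩
          t n + η + η
            ≡⟨ solve 2 (λ t h → t :+ h :+ h := t :+ h :+ h :+ h :- h) refl (t n) η ⟩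
          t n + η + η + η - η
            ≤⟨ +-monoˡ-≤ (- η) (begin
                 t n + η + η + η
                   ≤⟨ by-difference (η + η + η + η + η)
                        (solve 2 (λ t d → let h = d :* con ½ :* con ½ :* con ½ in
                          t :+ d :- (t :+ h :+ h :+ h) := h :+ h :+ h :+ h :+ h) refl (t n) δ)
                        (0≤+ (0≤+ (0≤+ (0≤+ (<⇒≤ 0<η) (<⇒≤ 0<η)) (<⇒≤ 0<η)) (<⇒≤ 0<η)) (<⇒≤ 0<η)) ⟩
                 t n + δ  ≤⟨ <⇒≤ t+δ<s ⟩
                 s n      ≤⟨ dist⇒≤ (s n) (s m) (hs n m (M≤ K≤n) (M≤ K≤m)) ⟩
                 s m + η ∎) ⟩
          s m + η - η
            ≡⟨ solve 2 (λ s h → s :+ h :- h := s) refl (s m) η ⟩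
          s m ∎ )

  ≲-approx : ∀ {s t} → (∀ δ → 0ℚ < δ → s ≲ (λ n → t n + δ)) → s ≲ t
  ≲-approx {s} {t} h = lim≤ λ δ 0<δ → ev-map
    (λ {n} p → subst (s n ≤_) (trans (+-assoc (t n) _ _) (cong (t n +_) (½+½ δ))) p)
    (within (h (δ * ½) (0<½* 0<δ)) (δ * ½) (0<½* 0<δ))

  -- Distinct naturals are at least 1 apart, so limit comparison of constants is exact.
  ι-cancel-≲ : ∀ a b → (λ _ → ι a) ≲ (λ _ → ι b) → a ℕ.≤ b
  ι-cancel-≲ a b a≲b = ℕₚ.≮⇒≥ λ b<a → ≲⇒≯ a≲b
    (1ℚ , 0<1 , 0 , λ _ _ → subst (_≤ ι a) (trans (ι-suc b) (+-comm 1ℚ (ι b))) (ι-mono b<a))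

  -- qʲ / j! ≥ Aʲ as long as A j ≤ q, since each further factor q / j is at least A.
  term-growth : ∀ {q} A k → ι A * ι k ≤ q → ∀ j → j ℕ.≤ k → ι (A ℕ.^ j) ≤ term q j
  term-growth A k h zero j≤k = ≤-refl
  term-growth {q} A k h (suc j) j<k = *-cancelʳ-≤-pos (ι (suc j)) {{ι-pos j}} (begin
    ι (A ℕ.* A ℕ.^ j) * ι (suc j)
      ≡⟨ cong (_* ι (suc j)) (ι-* A (A ℕ.^ j)) ⟩
    ι A * ι (A ℕ.^ j) * ι (suc j)
      ≡⟨ solve 3 (λ a b c → a :* b :* c := b :* (a :* c)) refl (ι A) (ι (A ℕ.^ j)) (ι (suc j)) ⟩
    ι (A ℕ.^ j) * (ι A * ι (suc j))
      ≤⟨ *-mono (0≤* (0≤ι A) (0≤ι (suc j))) (≤-trans (0≤ι (A ℕ.^ j)) ih)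
           ih (≤-trans (*-monoˡ-≤-nonNeg (ι A) {{nonNegative (0≤ι A)}} (ι-mono j<k)) h) ⟩
    term q j * q
      ≡⟨ ExpBounds.term-step q j ⟨
    term q (suc j) * ι (suc j) ∎)
    where
    ih = term-growth A k h j (ℕₚ.<⇒≤ j<k)

  term≤expSum : ∀ {q} → 0ℚ ≤ q → ∀ k n → k ℕ.< n → term q k ≤ expSum q n
  term≤expSum {q} 0≤q k (suc n) k<n with k ℕ.≟ n
  ... | yes refl = subst (_≤ expSum q n + term q n) (+-identityˡ _)
    (+-monoˡ-≤ (term q n) (ExpBounds.0≤expSum 0≤q n))
  ... | no k≢n = ≤-trans (term≤expSum 0≤q k n (ℕₚ.≤∧≢⇒< (ℕ.s≤s⁻¹ k<n) k≢n))
    (subst (_≤ expSum q n + term q n) (+-identityʳ _)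
      (+-monoʳ-≤ (expSum q n) (ExpBounds.0≤term 0≤q n)))

  -- A single term of the series, the k-th, already gives e^l ≥ A^k when l ≥ A k; the n-th partial
  -- sum contains it once n > k.
  exp-growth : ∀ {l : ℕ → ℚ} A k → Eventually (λ n → ι A * ι k ≤ l n) →
    Eventually (λ n → ι (A ℕ.^ k) ≤ expSum (l n) n)
  exp-growth A k ev = ev-map
    (λ {n} (h , k<n) → ≤-trans (term-growth A k h k ℕₚ.≤-refl)
      (term≤expSum (≤-trans (0≤* (0≤ι A) (0≤ι k)) h) k n k<n))
    (ev ⊗ (suc k , λ _ k<n → k<n))

  least-multiple : ∀ A .{{_ : ℕ.NonZero A}} q → ∃ λ s → q ≤ ι A * ι s ×
    (∀ k → suc k ≡ s → ι A * ι k < q)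
  least-multiple A q = let (m , q≤m) = ι≥ q in search m (≤-trans q≤m (begin
    ι m          ≤⟨ ι-mono (ℕₚ.m≤n*m m A) ⟩
    ι (A ℕ.* m)  ≡⟨ ι-* A m ⟩
    ι A * ι m ∎))
    where
    search : ∀ m → q ≤ ι A * ι m → ∃ λ s → q ≤ ι A * ι s × (∀ k → suc k ≡ s → ι A * ι k < q)
    search zero    h = 0 , h , λ _ ()
    search (suc m) h with q ≤? ι A * ι m
    ... | yes h' = search m h'
    ... | no  h' = suc m , h , λ { _ refl → ≰⇒> h' }

  -- Order against a real limit cannot be decided, so l is frozen at an index N beyond which it
  -- varies by less than 1, and A s is the least multiple above l N + 1. Minimality gives A (s - 1)
  -- < l N + 1 ≤ l n + 2, and subtracting A ≥ 2 leaves A (s - 2) ≤ l n; hence the loss of two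
  -- multiples.
  approximate-multiple : ∀ A .{{_ : ℕ.NonZero A}} {l} → 2 ℕ.≤ A → Cauchy l →
    ∃ λ s → Eventually (λ n → l n ≤ ι A * ι s) ×
    (∀ k → suc (suc k) ≡ s → Eventually (λ n → ι A * ι k ≤ l n))
  approximate-multiple A {l} 2≤A cl =
    let (N , h) = cl 1ℚ 0<1
        (s , upper , lower) = least-multiple A (l N + 1ℚ)
        N≤N = ℕₚ.≤-refl {N}
    in s , (N , λ n N≤n → ≤-trans (dist⇒≤ (l n) (l N) (h n N N≤n N≤N)) upper) ,
       λ k e → N , λ n N≤n → begin
         ι A * ι k
           ≡⟨ solve 2 (λ a k → a :* k := a :* (con 1ℚ :+ k) :- a) refl (ι A) (ι k) ⟩
         ι A * (1ℚ + ι k) - ι A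
           ≡⟨ cong (λ z → ι A * z - ι A) (ι-suc k) ⟨
         ι A * ι (suc k) - ι A
           ≤⟨ +-mono-≤ (<⇒≤ (lower (suc k) e)) (neg-antimono-≤ (ι-mono 2≤A)) ⟩
         l N + 1ℚ - ι 2
           ≤⟨ +-monoˡ-≤ (- ι 2) (+-monoˡ-≤ 1ℚ (dist⇒≤ (l N) (l n) (h N n N≤N N≤n))) ⟩
         l n + 1ℚ + 1ℚ - ι 2
           ≡⟨ solve 1 (λ x → x :+ con 1ℚ :+ con 1ℚ :- con (ι 2) := x) refl (l n) ⟩
         l n ∎

-- The graphs: complete bipartite, with a target attached to one side.

module Bipartite where

  open import Defs
    using (Graph; Subgraph; InCore; coreness; coreness-correct; DifferInAtMostOneEdge; adj)
  open import Data.Bool using (Bool; true; false; T)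
  open import Data.Fin using (Fin; zero; suc; toℕ)
  open import Data.Fin.Properties using (toℕ-injective)
  open import Data.Fin.Subset using (∣_∣; _∈_)
  open import Data.Nat using (ℕ; zero; suc; _+_; _≤_; _<_; z≤n; s≤s; s≤s⁻¹)
  open import Data.Nat.Properties
  open import Data.Empty using (⊥-elim)
  open import Data.Product using (_×_; _,_; proj₁; proj₂)
  open import Data.Sum as Sum using (_⊎_; inj₁; inj₂; [_,_]′)
  open import Data.Unit using (tt)
  open import Data.Vec using (tabulate)
  open import Data.Vec.Properties using (lookup∘tabulate; []=⇒lookup; lookup⇒[]=)
  open import Function using (_∘_; mk⇔)
  open import Relation.Nullary using (¬_; Dec; yes; no; does; _×-dec_; _⊎-dec_)
  open import Relation.Nullary.Decidable using (dec-true; dec-false; does-⇔)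
  open import Relation.Binary.PropositionalEquality

  count-interval : ∀ {n} (f : Fin n → Bool) lo len → lo + len ≤ n →
    (∀ u → lo ≤ toℕ u → toℕ u < lo + len → T (f u)) → len ≤ ∣ tabulate f ∣
  count-interval f zero zero _ _ = z≤n
  count-interval {suc n} f zero (suc len) (s≤s le) h with f zero | h zero z≤n (s≤s z≤n)
  ... | true | _ = s≤s (count-interval (f ∘ suc) zero len le λ u _ lt → h (suc u) z≤n (s≤s lt))
  count-interval {suc n} f (suc lo) len (s≤s le) h with f zero
  ... | true  = m≤n⇒m≤1+n (count-interval (f ∘ suc) lo len le λ u ge lt → h (suc u) (s≤s ge) (s≤s lt))
  ... | false = count-interval (f ∘ suc) lo len le λ u ge lt → h (suc u) (s≤s ge) (s≤s lt)

  count-none : ∀ {n} (f : Fin n → Bool) → (∀ u → ¬ T (f u)) → ∣ tabulate f ∣ ≡ 0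
  count-none {zero}  f h = refl
  count-none {suc n} f h with f zero | h zero
  ... | true  | ¬t = ⊥-elim (¬t tt)
  ... | false | _  = count-none (f ∘ suc) (h ∘ suc)

  does⁻ : ∀ {A : Set} (d : Dec A) → T (does d) → A
  does⁻ (yes a) _ = a

  does⁺ : ∀ {A : Set} (d : Dec A) → A → T (does d)
  does⁺ (yes _) _ = tt
  does⁺ (no ¬a) a = ¬a a

  -- The complete bipartite graph between [0, s) and [s, 2s), to which t is added on the
  -- right side with neighbourhood [0, j).

  Half : (s t j a b : ℕ) → Set
  Half s t j a b = a < s × s ≤ b × (b < s + s ⊎ (b ≡ t × a < j))

  Joined : (s t j a b : ℕ) → Set
  Joined s t j a b = Half s t j a b ⊎ Half s t j b a

  half? : ∀ s t j a b → Dec (Half s t j a b)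
  half? s t j a b = (a <? s) ×-dec (s ≤? b) ×-dec ((b <? s + s) ⊎-dec ((b ≟ t) ×-dec (a <? j)))

  joined? : ∀ s t j a b → Dec (Joined s t j a b)
  joined? s t j a b = half? s t j a b ⊎-dec half? s t j b a

  bipartite : (s t j n : ℕ) → Graph n
  bipartite s t j n = record
    { adj        = λ u w → does (joined? s t j (toℕ u) (toℕ w))
    ; adj-sym    = λ u w → does-⇔ (mk⇔ Sum.swap Sum.swap)
                     (joined? s t j (toℕ u) (toℕ w)) (joined? s t j (toℕ w) (toℕ u))
    ; adj-irrefl = λ u → dec-false (joined? s t j (toℕ u) (toℕ u))
                     [ irrefl (toℕ u) , irrefl (toℕ u) ]′
    }
    where
    irrefl : ∀ a → ¬ Half s t j a a
    irrefl a (a<s , s≤a , _) = <⇒≱ a<s s≤a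

  -- Neighbouring graphs on the path.

  module _ (s t : ℕ) where

    half-suc : ∀ {j a b} → Half s t j a b → Half s t (suc j) a b
    half-suc (p , q , r) = p , q , Sum.map₂ (λ (e , lt) → e , m<n⇒m<1+n lt) r

    half-pred : ∀ {j a b} → ¬ (a ≡ j × b ≡ t) → Half s t (suc j) a b → Half s t j a b
    half-pred ne (p , q , inj₁ r) = p , q , inj₁ r
    half-pred ne (p , q , inj₂ (e , lt)) =
      p , q , inj₂ (e , ≤∧≢⇒< (s≤s⁻¹ lt) λ a≡j → ne (a≡j , e))

    -- Only the clause a < j of `Half` involves j, and passing from j to j + 1 affects it only at a
    -- = j, b = t.
    differs-at : ∀ {j n} u w → adj (bipartite s t j n) u w ≢ adj (bipartite s t (suc j) n) u w →
      (toℕ u ≡ j × toℕ w ≡ t) ⊎ (toℕ w ≡ j × toℕ u ≡ t)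
    differs-at {j} u w d
      with ((toℕ u ≟ j) ×-dec (toℕ w ≟ t)) ⊎-dec ((toℕ w ≟ j) ×-dec (toℕ u ≟ t))
    ... | yes p = p
    ... | no ¬p = ⊥-elim (d (does-⇔
      (mk⇔ (Sum.map half-suc half-suc)
           (Sum.map (half-pred (¬p ∘ inj₁)) (half-pred (¬p ∘ inj₂))))
      (joined? s t j (toℕ u) (toℕ w)) (joined? s t (suc j) (toℕ u) (toℕ w))))

    bipartite-step : ∀ j n → DifferInAtMostOneEdge (bipartite s t (suc j) n) (bipartite s t j n)
    bipartite-step j n a b c d ab cd
      with differs-at a b (ab ∘ sym) | differs-at c d (cd ∘ sym)
    ... | inj₁ (p , q) | inj₁ (p' , q') = inj₁ (same p p' , same q q')
      where
      same : ∀ {u w : Fin n} {k} → toℕ u ≡ k → toℕ w ≡ k → u ≡ w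
      same p q = toℕ-injective (trans p (sym q))
    ... | inj₁ (p , q) | inj₂ (p' , q') =
      inj₂ (toℕ-injective (trans p (sym p')) , toℕ-injective (trans q (sym q')))
    ... | inj₂ (p , q) | inj₁ (p' , q') =
      inj₂ (toℕ-injective (trans q (sym q')) , toℕ-injective (trans p (sym p')))
    ... | inj₂ (p , q) | inj₂ (p' , q') =
      inj₁ (toℕ-injective (trans q (sym q')) , toℕ-injective (trans p (sym p')))

  -- For j = 0 the clause about the target is void, so the edges are the same and no pair witnesses
  -- a difference.
  bipartite-base : ∀ s t t' n → DifferInAtMostOneEdge (bipartite s t 0 n) (bipartite s t' 0 n)
  bipartite-base s t t' n a b _ _ ab _ = ⊥-elim (ab (does-⇔
    (mk⇔ (Sum.map half-base half-base) (Sum.map half-base half-base))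
    (joined? s t 0 (toℕ a) (toℕ b)) (joined? s t' 0 (toℕ a) (toℕ b))))
    where
    half-base : ∀ {t t' a b} → Half s t 0 a b → Half s t' 0 a b
    half-base (p , q , inj₁ r) = p , q , inj₁ r

  -- Coreness of the target and of the other outside vertices.

  module _ (s n : ℕ) (2s≤n : s + s ≤ n) where

    joined-core : ∀ t {j a b} → Joined s t j a b → a < s + s ⊎ a ≡ t
    joined-core t (inj₁ (a<s , _ , _)) = inj₁ (<-≤-trans a<s (m≤m+n s s))
    joined-core t (inj₂ (_ , _ , r)) = Sum.map₂ proj₁ r

    -- The witness consists of [0, 2s) and the target, with all edges of the graph: a left vertex
    -- sees [s, 2s), while a right vertex and the target see [0, s).
    coreness-target : ∀ v → s + s ≤ toℕ v → s ≤ coreness (bipartite s (toℕ v) s n) v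
    coreness-target v 2s≤v =
      proj₂ (coreness-correct (bipartite s t s n) v) s (core , ∈⁺ (inj₂ refl) , degree)
      where
      t = toℕ v
      core? : ∀ u → Dec (toℕ u < s + s ⊎ toℕ u ≡ t)
      core? u = (toℕ u <? s + s) ⊎-dec (toℕ u ≟ t)
      ∈⁺ : ∀ {u : Fin n} → toℕ u < s + s ⊎ toℕ u ≡ t → u ∈ tabulate (does ∘ core?)
      ∈⁺ {u} h = lookup⇒[]= u _ (trans (lookup∘tabulate _ u) (dec-true (core? u) h))
      ∈⁻ : ∀ {u : Fin n} → u ∈ tabulate (does ∘ core?) → toℕ u < s + s ⊎ toℕ u ≡ t
      ∈⁻ {u} h = does⁻ (core? u)
        (subst T (trans (sym ([]=⇒lookup h)) (lookup∘tabulate _ u)) tt)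
      core : Subgraph (bipartite s t s n)
      core = record
        { verts    = tabulate (does ∘ core?)
        ; edge     = adj (bipartite s t s n)
        ; edge-sym = Graph.adj-sym (bipartite s t s n)
        ; edge-adj = λ e → e
        ; edge-end = λ {u} {w} e →
            ∈⁺ (joined-core t (does⁻ (joined? s t s (toℕ u) (toℕ w)) e))
        }
      degree : ∀ u → u ∈ Subgraph.verts core → s ≤ Subgraph.deg core u
      degree u u∈ with toℕ u <? s
      ... | yes u<s = count-interval _ s s 2s≤n λ w ge lt →
        does⁺ (joined? s t s (toℕ u) (toℕ w)) (inj₁ (u<s , ge , inj₁ lt))
      ... | no u≮s = count-interval _ 0 s (≤-trans (m≤m+n s s) 2s≤n) λ w _ lt →
        does⁺ (joined? s t s (toℕ u) (toℕ w))
          (inj₂ (lt , ≮⇒≥ u≮s , Sum.map₂ (λ e → e , lt) (∈⁻ u∈)))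

    -- By `joined-core` such a vertex is isolated, so it has degree 0 in every subgraph.
    coreness-other : ∀ t v → s + s ≤ toℕ v → toℕ v ≢ t → coreness (bipartite s t s n) v ≡ 0
    coreness-other t v 2s≤v v≢t = zero-core (proj₁ (coreness-correct (bipartite s t s n) v))
      where
      zero-core : ∀ {k} → InCore (bipartite s t s n) v k → k ≡ 0
      zero-core (H , v∈H , h) = n≤0⇒n≡0 (subst (_ ≤_)
        (count-none (Subgraph.edge H v) λ w e →
          [ (λ lt → <⇒≱ lt 2s≤v) , v≢t ]′ (joined-core t
            (does⁻ (joined? s t s (toℕ v) (toℕ w)) (Subgraph.edge-adj H e))))
        (h v v∈H))

open import Defs
open import Data.Nat using (ℕ)
open import Data.Product using (∃; _×_)

open Sequences
open Bipartite
open Rat using (ι; 0≤ι)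
open import Data.Empty using (⊥; ⊥-elim)
open import Data.Fin using (Fin; toℕ; fromℕ<)
open import Data.Fin.Properties using (toℕ<n; toℕ-fromℕ<; toℕ-injective)
open import Data.Nat as ℕ using (zero; suc)
import Data.Nat.Properties as ℕₚ
open import Data.Product using (_,_; proj₁; proj₂)
open import Data.Rational as ℚ using (ℚ; 0ℚ; 1ℚ)
import Data.Rational.Properties as ℚₚ
open import Data.Rational.Solver using (module +-*-Solver)
open import Level using (0ℓ)
open import Relation.Binary.PropositionalEquality
open import Relation.Nullary using (¬_; yes; no)
open import Relation.Unary using (Pred; _⊆_)

-- `x ≤ y` unfolds to the negation of `seq y ≪ seq x`, so the comparison of sequences applies
-- directly.
≤⇒≲ : ∀ x y → x ≤ y → seq x ≲ seq y
≤⇒≲ x y = ≯⇒≲ (cauchy x) (cauchy y)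

≈⇒≲ : ∀ x y → x ≈ y → seq x ≲ seq y
≈⇒≲ x y x≈y = lim≤ λ δ 0<δ → ev-map (dist⇒≤ _ _) (x≈y δ 0<δ)

-- Each term is the reciprocal of a maximum with δ > 0, so the sign is known at every index and not
-- only eventually.
inverse-nonneg : ∀ x (0<x : 0ℝ < x) i → 0ℚ ℚ.≤ seq (inverse x 0<x) i
inverse-nonneg x (δ , 0<δ , _) i = ℚₚ.<⇒≤ (Rat.recip-pos δ 0<δ (seq x i))

-- Probabilities of disjoint events.

module _ {n : ℕ} (X : RandomVector n) where
  open RandomVector X
  open ProbabilitySpace space hiding (resp-≐)
    renaming (full to U-measurable; union to ⋃-measurable)

  Pr-nonneg : ∀ {Y} (bY : Borel Y) → (λ _ → 0ℚ) ≲ seq Pr[ X ∈ bY ]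
  Pr-nonneg bY = ≤⇒≲ 0ℝ Pr[ X ∈ bY ] (nonneg (measurable bY))

  Pr-mono : ∀ {Y Z} (bY : Borel Y) (bZ : Borel Z) → Y ⊆ Z →
    seq Pr[ X ∈ bY ] ≲ seq Pr[ X ∈ bZ ]
  Pr-mono bY bZ Y⊆Z =
    ≤⇒≲ Pr[ X ∈ bY ] Pr[ X ∈ bZ ] (monotone (measurable bY) (measurable bZ) Y⊆Z)

  module _ {Y : ℕ → Pred (Fin n → ℝ) 0ℓ} (bY : ∀ i → Borel (Y i)) where

    partialSum : ℕ → ℕ → ℚ
    partialSum m = seq (∑ (λ i → Pr[ X ∈ bY i ]) m)

    partial-sums-increase : ∀ k m → partialSum m ≲ partialSum (k ℕ.+ m)
    partial-sums-increase zero    m = ≲-refl (partialSum m)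
    partial-sums-increase (suc k) m = ≲-trans (partial-sums-increase k m)
      (≲-trans (≡⇒≲ λ i → sym (ℚₚ.+-identityʳ (partialSum (k ℕ.+ m) i)))
        (≲-+ (≲-refl (partialSum (k ℕ.+ m))) (Pr-nonneg (bY (k ℕ.+ m)))))

    -- Additivity controls only late partial sums. The m-th one is at most the (m + N)-th, which is
    -- below P of the union plus δ, hence below 1 + δ.
    disjoint-sum≤1 : (∀ i j → i ≢ j → ∀ y → Y i y → ¬ Y j y) → ∀ m → partialSum m ≲ (λ _ → 1ℚ)
    disjoint-sum≤1 disjoint m = ≲-approx λ δ 0<δ →
      let (N , close) = additive (λ i → measurable (bY i))
            (λ i j i≢j ω → disjoint i j i≢j (value ω))
            (fromℚ δ) (δ , 0<δ , 0 , λ _ _ → ℚₚ.≤-reflexive (ℚₚ.+-identityˡ δ))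
          (η , 0<η , sum+η≤) = proj₂ (close (m ℕ.+ N) (ℕₚ.m≤n+m N m))
          total : seq (P (⋃-measurable (λ i → measurable (bY i)))) ≲ (λ _ → 1ℚ)
          total = ≲-trans
            (≤⇒≲ (P (⋃-measurable (λ i → measurable (bY i)))) (P U-measurable)
              (monotone (⋃-measurable (λ i → measurable (bY i))) U-measurable _))
            (≈⇒≲ (P U-measurable) 1ℝ P-full)
      in ≲-trans (subst (λ k → partialSum m ≲ partialSum k) (ℕₚ.+-comm N m) (partial-sums-increase N m))
           (≲-trans (eventually⇒≲ (ev-map
               (λ {i} → ℚₚ.≤-trans (ℚₚ.≤-trans
                 (ℚₚ.≤-reflexive (sym (ℚₚ.+-identityʳ (partialSum (m ℕ.+ N) i))))
                 (ℚₚ.+-monoʳ-≤ (partialSum (m ℕ.+ N) i) (ℚₚ.<⇒≤ 0<η)))) sum+η≤))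
             (≲-+ total (≲-refl (λ _ → δ))))

  module _ {m : ℕ} {Y : Fin m → Pred (Fin n → ℝ) 0ℓ} (bY : ∀ i → Borel (Y i)) where

    -- Continues the finite family by empty events, since additivity is stated for sequences of
    -- events.
    Padded : ℕ → Pred (Fin n → ℝ) 0ℓ
    Padded i y = ∃ λ (i<m : i ℕ.< m) → Y (fromℕ< i<m) y

    Padded-borel : ∀ i → Borel (Padded i)
    Padded-borel i with i ℕ.<? m
    ... | yes i<m = resp-≐ ((λ a → i<m , a) , (λ (_ , a) → a)) (bY (fromℕ< i<m))
    ... | no  i≮m = resp-≐ ((λ ()) , (λ (i<m , _) → ⊥-elim (i≮m i<m))) ∅-borel

    -- A packing bound: summing x ≤ K Pr(Y i) over the m disjoint events leaves at most K on the
    -- right.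
    Pr-union-bound : (∀ i j → i ≢ j → ∀ y → Y i y → ¬ Y j y) → ∀ {x} K →
      (∀ i → x ≲ (λ k → ι K ℚ.* seq Pr[ X ∈ bY i ] k)) →
      (λ k → ι m ℚ.* x k) ≲ (λ _ → ι K)
    Pr-union-bound disjoint {x} K h = ≲-trans (partial m ℕₚ.≤-refl)
      (≲-trans (≲-* (ι K) (0≤ι K) (disjoint-sum≤1 Padded-borel padded-disjoint m))
        (≡⇒≲ λ _ → ℚₚ.*-identityʳ (ι K)))
      where
      padded-disjoint : ∀ i j → i ≢ j → ∀ y → Padded i y → ¬ Padded j y
      padded-disjoint i j i≢j y (i<m , a) (j<m , b) = disjoint _ _
        (λ e → i≢j (trans (sym (toℕ-fromℕ< i<m)) (trans (cong toℕ e) (toℕ-fromℕ< j<m)))) y a b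
      partial : ∀ k → k ℕ.≤ m →
        (λ i → ι k ℚ.* x i) ≲ (λ i → ι K ℚ.* partialSum Padded-borel k i)
      partial zero    _ = ≡⇒≲ λ i → trans (ℚₚ.*-zeroˡ (x i)) (sym (ℚₚ.*-zeroʳ (ι K)))
      partial (suc k) k<m = ≲-trans (≡⇒≲ λ i → trans (cong (ℚ._* x i) (Rat.ι-suc k))
          (solve 2 (λ k x → (con 1ℚ :+ k) :* x := k :* x :+ x) refl (ι k) (x i)))
        (≲-trans (≲-+ (partial k (ℕₚ.<⇒≤ k<m))
            (≲-trans (h (fromℕ< k<m)) (≲-* (ι K) (0≤ι K)
              (Pr-mono (bY (fromℕ< k<m)) (Padded-borel k) (λ a → k<m , a)))))
          (≡⇒≲ λ i → sym (ℚₚ.*-distribˡ-+ (ι K) (partialSum Padded-borel k i)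
            (seq Pr[ X ∈ Padded-borel k ] i))))
        where open +-*-Solver

-- Privacy loss along a path of graphs.

module _ {n : ℕ} (ε : ℝ) (E : ℕ) (exp≤E : Eventually (λ i → ℚ.∣ seq (exp ε) i ∣ ℚ.≤ ι E))
  (0<E : 0ℚ ℚ.< ι E) (M : Mechanism n) (dp : EdgeDP ε M) where

  -- Replacing e^ε by a natural number E makes the accumulated loss a power in the naturals.
  dp-step : ∀ G G' → DifferInAtMostOneEdge G G' → ∀ {Y} (bY : Borel Y) →
    seq Pr[ M G ∈ bY ] ≲ (λ i → ι E ℚ.* seq Pr[ M G' ∈ bY ] i)
  dp-step G G' d bY = ≲-trans
    (≤⇒≲ Pr[ M G ∈ bY ] (exp ε * Pr[ M G' ∈ bY ]) (dp G G' d bY))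
    (≲-*-bounded (ι E) 0<E exp≤E (Pr-nonneg (M G') bY))

  -- The graphs with j = 0 have equal edges but are not definitionally equal for
  -- different t; the step between them accounts for the extra factor E.
  dp-path : ∀ s t t' j {Y} (bY : Borel Y) → seq Pr[ M (bipartite s t j n) ∈ bY ] ≲
    (λ i → ι (E ℕ.^ suc j) ℚ.* seq Pr[ M (bipartite s t' 0 n) ∈ bY ] i)
  dp-path s t t' zero bY = ≲-trans
    (dp-step (bipartite s t 0 n) (bipartite s t' 0 n) (bipartite-base s t t' n) bY)
    (≡⇒≲ λ i → cong (λ k → ι k ℚ.* seq Pr[ M (bipartite s t' 0 n) ∈ bY ] i)
      (sym (ℕₚ.*-identityʳ E)))
  dp-path s t t' (suc j) bY = ≲-trans
    (dp-step (bipartite s t (suc j) n) (bipartite s t j n) (bipartite-step s t j n) bY)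
    (≲-trans (≲-* (ι E) (0≤ι E) (dp-path s t t' j bY))
      (≡⇒≲ λ i → trans (sym (ℚₚ.*-assoc (ι E) (ι (E ℕ.^ suc j)) (q i)))
        (cong (ℚ._* q i) (sym (ι-* E (E ℕ.^ suc j))))))
    where q = seq Pr[ M (bipartite s t' 0 n) ∈ bY ]

-- Accurate outputs as disjoint events, and the packing bound.

module _ {n : ℕ} (γ : ℝ) (0<γ : 0ℝ < γ) (α : ℝ) where

  Accepted : Graph n → Pred (Fin n → ℝ) 0ℓ
  Accepted G = Between (λ v → inverse γ 0<γ * fromℕ (coreness G v) - α)
                       (λ v → γ * fromℕ (coreness G v) + α)

  Accepted-borel : ∀ G → Borel (Accepted G)
  Accepted-borel G = Between-borel (λ v → inverse γ 0<γ * fromℕ (coreness G v) - α)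
                                   (λ v → γ * fromℕ (coreness G v) + α)

  -- A common output y would satisfy s / γ - α ≤ y v ≤ γ 0 + α at the vertex v, against 2 α < s / γ.
  accepted-disjoint : ∀ s → (λ i → seq α i ℚ.+ seq α i) ≪ (λ i → seq (inverse γ 0<γ) i ℚ.* ι s) →
    ∀ G G' v → s ℕ.≤ coreness G v → coreness G' v ≡ 0 →
    ∀ y → Accepted G y → ¬ Accepted G' y
  accepted-disjoint s (δ , 0<δ , gap) G G' v s≤k k'≡0 y a a' = ≲⇒≯
    (≲-trans (≤⇒≲ (inverse γ 0<γ * fromℕ (coreness G v) - α) (y v) (proj₁ (a v)))
      (≤⇒≲ (y v) (γ * fromℕ (coreness G' v) + α) (proj₂ (a' v))))
    (δ , 0<δ , ev-map (λ {i} h → step i h) gap)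
    where
    open ℚₚ.≤-Reasoning
    open +-*-Solver
    g = seq (inverse γ 0<γ)
    step : ∀ i → seq α i ℚ.+ seq α i ℚ.+ δ ℚ.≤ g i ℚ.* ι s →
      seq γ i ℚ.* ι (coreness G' v) ℚ.+ seq α i ℚ.+ δ ℚ.≤
      g i ℚ.* ι (coreness G v) ℚ.- seq α i
    step i h = begin
      seq γ i ℚ.* ι (coreness G' v) ℚ.+ seq α i ℚ.+ δ
        ≡⟨ cong (λ k → seq γ i ℚ.* ι k ℚ.+ seq α i ℚ.+ δ) k'≡0 ⟩
      seq γ i ℚ.* ι 0 ℚ.+ seq α i ℚ.+ δ
        ≡⟨ solve 3 (λ c a d → c :* con 0ℚ :+ a :+ d := a :+ a :+ d :- a) refl
             (seq γ i) (seq α i) δ ⟩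
      seq α i ℚ.+ seq α i ℚ.+ δ ℚ.- seq α i
        ≤⟨ ℚₚ.+-monoˡ-≤ (ℚ.- seq α i) (ℚₚ.≤-trans h
             (ℚₚ.*-monoˡ-≤-nonNeg (g i) {{ℚ.nonNegative (inverse-nonneg γ 0<γ i)}}
               (Rat.ι-mono s≤k))) ⟩
      g i ℚ.* ι (coreness G v) ℚ.- seq α i ∎

target-count-bound : ∀ {n} (ε : ℝ) (E : ℕ) → Eventually (λ i → ℚ.∣ seq (exp ε) i ∣ ℚ.≤ ι E) →
  0ℚ ℚ.< ι E → (M : Mechanism n) → EdgeDP ε M →
  ∀ γ 0<γ α p → Accurate γ 0<γ α p M →
  ∀ s → s ℕ.+ s ℕ.≤ n → (λ i → seq α i ℚ.+ seq α i) ≪ (λ i → seq (inverse γ 0<γ) i ℚ.* ι s) →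
  (λ i → ι (n ℕ.∸ (s ℕ.+ s)) ℚ.* seq p i) ≲ (λ _ → ι (E ℕ.^ suc s))
target-count-bound {n} ε E exp≤E 0<E M dp γ 0<γ α p accurate s 2s≤n gap =
  -- All events are measured on one reference graph; with j = 0 the target label 0 has no effect on
  -- its edges.
  Pr-union-bound (M (bipartite s 0 0 n)) (λ i → Accepted-borel γ 0<γ α (G i)) disjoint
    (E ℕ.^ suc s) λ i → ≲-trans
      (≤⇒≲ p Pr[ M (G i) ∈ Accepted-borel γ 0<γ α (G i) ] (accurate (G i)))
      (dp-path ε E exp≤E 0<E M dp s (toℕ (target i)) 0 s (Accepted-borel γ 0<γ α (G i)))
  where
  m = n ℕ.∸ (s ℕ.+ s)
  target<n : ∀ (i : Fin m) → s ℕ.+ s ℕ.+ toℕ i ℕ.< n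
  target<n i = ℕₚ.<-≤-trans (ℕₚ.+-monoʳ-< (s ℕ.+ s) (toℕ<n i))
    (ℕₚ.≤-reflexive (ℕₚ.m+[n∸m]≡n 2s≤n))
  target : Fin m → Fin n
  target i = fromℕ< (target<n i)
  toℕ-target : ∀ i → toℕ (target i) ≡ s ℕ.+ s ℕ.+ toℕ i
  toℕ-target i = toℕ-fromℕ< (target<n i)
  2s≤target : ∀ i → s ℕ.+ s ℕ.≤ toℕ (target i)
  2s≤target i = subst (s ℕ.+ s ℕ.≤_) (sym (toℕ-target i)) (ℕₚ.m≤m+n (s ℕ.+ s) (toℕ i))
  G : Fin m → Graph n
  G i = bipartite s (toℕ (target i)) s n
  disjoint : ∀ i j → i ≢ j → ∀ y → Accepted γ 0<γ α (G i) y → ¬ Accepted γ 0<γ α (G j) y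
  disjoint i j i≢j = accepted-disjoint γ 0<γ α s gap (G i) (G j) (target i)
    (coreness-target s n 2s≤n (target i) (2s≤target i))
    (coreness-other s n 2s≤n (toℕ (target j)) (target i) (2s≤target i)
      λ e → i≢j (toℕ-injective (ℕₚ.+-cancelˡ-≡ (s ℕ.+ s) (toℕ i) (toℕ j)
        (trans (sym (toℕ-target i)) (trans e (toℕ-target j))))))

-- Choice of constants and the final contradiction.

n≤m^n : ∀ m → 2 ℕ.≤ m → ∀ n → n ℕ.≤ m ℕ.^ n
n≤m^n m 2≤m zero    = ℕ.z≤n
n≤m^n m@(suc _) 2≤m (suc n) = begin
  1 ℕ.+ n              ≤⟨ ℕₚ.+-mono-≤ (ℕₚ.m^n>0 m n) (n≤m^n m 2≤m n) ⟩
  m ℕ.^ n ℕ.+ m ℕ.^ n  ≡⟨ cong (m ℕ.^ n ℕ.+_) (ℕₚ.+-identityʳ (m ℕ.^ n)) ⟨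
  2 ℕ.* m ℕ.^ n        ≤⟨ ℕₚ.*-monoˡ-≤ (m ℕ.^ n) 2≤m ⟩
  m ℕ.^ suc n ∎
  where open ℕₚ.≤-Reasoning

module _ (E : ℕ) .{{_ : ℕ.NonZero E}} (2≤E : 2 ℕ.≤ E) where

  -- Raising A to the power k + 1 must beat 2 E^(k + 4), the bound for s = k + 3.
  A : ℕ
  A = 4 ℕ.* E ℕ.^ 4

  -- Twice the packing bound E^(s+1): since n is at most twice the number of targets, n p cannot
  -- exceed it.
  threshold : ℕ → ℕ
  threshold s = E ℕ.^ suc s ℕ.+ E ℕ.^ suc s

  threshold-mono : ∀ {s s'} → s ℕ.≤ s' → threshold s ℕ.≤ threshold s'
  threshold-mono s≤s' = ℕₚ.+-mono-≤ E^≤ E^≤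
    where E^≤ = ℕₚ.^-monoʳ-≤ E (ℕ.s≤s s≤s')

  -- Ensures that n > `threshold s` leaves at least half of the vertices as targets.
  4s≤threshold : ∀ s → (s ℕ.+ s) ℕ.+ (s ℕ.+ s) ℕ.≤ threshold s
  4s≤threshold s = ℕₚ.+-mono-≤ 2s≤ 2s≤
    where
    open ℕₚ.≤-Reasoning
    2s≤ : s ℕ.+ s ℕ.≤ E ℕ.^ suc s
    2s≤ = begin
      s ℕ.+ s        ≡⟨ cong (s ℕ.+_) (ℕₚ.+-identityʳ s) ⟨
      2 ℕ.* s        ≤⟨ ℕₚ.*-mono-≤ 2≤E (n≤m^n E 2≤E s) ⟩
      E ℕ.^ suc s ∎

  A-nonZero : ℕ.NonZero A
  A-nonZero = ℕₚ.m*n≢0 4 (E ℕ.^ 4) {{_}} {{ℕₚ.m^n≢0 E 4}}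

  2≤A : 2 ℕ.≤ A
  2≤A = ℕₚ.≤-trans (ℕ.s≤s (ℕ.s≤s ℕ.z≤n)) (ℕₚ.*-monoʳ-≤ 4 (ℕₚ.m^n>0 E 4))

  threshold<A^ : ∀ k → threshold (3 ℕ.+ k) ℕ.< A ℕ.^ suc k
  threshold<A^ k = begin-strict
    x ℕ.+ x                        <⟨ ℕₚ.+-monoʳ-< x (ℕₚ.m<m+n x (ℕₚ.m^n>0 E (4 ℕ.+ k))) ⟩
    x ℕ.+ (x ℕ.+ x)                ≤⟨ ℕₚ.+-monoʳ-≤ x (ℕₚ.+-monoʳ-≤ x (ℕₚ.m≤m+n x (x ℕ.+ 0))) ⟩
    4 ℕ.* x                        ≡⟨ cong (4 ℕ.*_) (ℕₚ.^-distribˡ-+-* E 4 k) ⟩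
    4 ℕ.* (E ℕ.^ 4 ℕ.* E ℕ.^ k)    ≡⟨ ℕₚ.*-assoc 4 (E ℕ.^ 4) (E ℕ.^ k) ⟨
    A ℕ.* E ℕ.^ k                  ≤⟨ ℕₚ.*-monoʳ-≤ A (ℕₚ.^-monoˡ-≤ k E≤A) ⟩
    A ℕ.^ suc k ∎
    where
    open ℕₚ.≤-Reasoning
    x = E ℕ.^ (4 ℕ.+ k)
    E≤A : E ℕ.≤ A
    E≤A = begin
      E              ≡⟨ ℕₚ.^-identityʳ E ⟨
      E ℕ.^ 1        ≤⟨ ℕₚ.^-monoʳ-≤ E {1} {4} (ℕ.s≤s ℕ.z≤n) ⟩
      E ℕ.^ 4        ≤⟨ ℕₚ.m≤n*m (E ℕ.^ 4) 4 ⟩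
      A ∎

  0<2A : 0ℚ ℚ.< ι A ℚ.+ ι A
  0<2A = ℚₚ.+-mono-< (0<ι A {{A-nonZero}}) (0<ι A {{A-nonZero}})

  -- The constant c = 1 / (2A): with ℓ ≤ A s, the assumption α < c ℓ / γ becomes 2 α < s / γ.
  scale : ℚ
  scale = (ℚ.1/ (ι A ℚ.+ ι A)) {{ℚ.>-nonZero 0<2A}}

  0<scale : 0ℝ < fromℚ scale
  0<scale = scale , Rat.0<1/ 0<2A , 0 , λ _ _ → ℚₚ.≤-reflexive (ℚₚ.+-identityˡ scale)

  -- For s = k + 3 the lower bound ℓ ≥ A (k + 1) gives e^ℓ ≥ A^(k+1), which exceeds the threshold.
  -- For s ≤ 2 the lower bound on ℓ is too weak, and `base`, the largeness of n p, takes over.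
  threshold≲ : ∀ {x : ℕ → ℚ} ℓ → seq (exp ℓ) ≲ x → (λ _ → ι (suc (threshold 2))) ≲ x →
    ∀ s → (∀ k → suc (suc k) ≡ s → Eventually (λ i → ι A ℚ.* ι k ℚ.≤ seq ℓ i)) →
    (λ _ → ι (suc (threshold s))) ≲ x
  threshold≲ ℓ expℓ≲x base s lower with s ℕ.≤? 2
  ... | yes s≤2 = ≲-trans
    (eventually⇒≲ (0 , λ _ _ → Rat.ι-mono (ℕ.s≤s (threshold-mono s≤2)))) base
  threshold≲ ℓ expℓ≲x base (suc (suc zero)) lower | no s≰2 = ⊥-elim (s≰2 ℕₚ.≤-refl)
  threshold≲ ℓ expℓ≲x base (suc zero) lower | no s≰2 = ⊥-elim (s≰2 (ℕ.s≤s ℕ.z≤n))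
  threshold≲ ℓ expℓ≲x base zero lower | no s≰2 = ⊥-elim (s≰2 ℕ.z≤n)
  threshold≲ ℓ expℓ≲x base (suc (suc (suc k))) lower | no _ = ≲-trans
    (eventually⇒≲ (ev-map (ℚₚ.≤-trans (Rat.ι-mono (threshold<A^ k)))
      (exp-growth A (suc k) (lower (suc k) refl))))
    expℓ≲x

  error-gap : ∀ {a g l : ℕ → ℚ} s → (∀ i → 0ℚ ℚ.≤ g i) →
    Eventually (λ i → l i ℚ.≤ ι A ℚ.* ι s) → a ≪ (λ i → scale ℚ.* (g i ℚ.* l i)) →
    (λ i → a i ℚ.+ a i) ≪ (λ i → g i ℚ.* ι s)
  error-gap {a} {g} {l} s 0≤g l≤ (δ , 0<δ , gap) = δ ℚ.+ δ , ℚₚ.+-mono-< 0<δ 0<δ ,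
    ev-map (λ {i} (u , v) → step i u v) (l≤ ⊗ gap)
    where
    open ℚₚ.≤-Reasoning
    open +-*-Solver
    step : ∀ i → l i ℚ.≤ ι A ℚ.* ι s → a i ℚ.+ δ ℚ.≤ scale ℚ.* (g i ℚ.* l i) →
      a i ℚ.+ a i ℚ.+ (δ ℚ.+ δ) ℚ.≤ g i ℚ.* ι s
    step i u v = begin
      a i ℚ.+ a i ℚ.+ (δ ℚ.+ δ)
        ≡⟨ solve 2 (λ a d → a :+ a :+ (d :+ d) := (a :+ d) :+ (a :+ d)) refl (a i) δ ⟩
      (a i ℚ.+ δ) ℚ.+ (a i ℚ.+ δ)
        ≤⟨ ℚₚ.+-mono-≤ v' v' ⟩
      scale ℚ.* (g i ℚ.* (ι A ℚ.* ι s)) ℚ.+ scale ℚ.* (g i ℚ.* (ι A ℚ.* ι s))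
        ≡⟨ solve 4 (λ c g A s → c :* (g :* (A :* s)) :+ c :* (g :* (A :* s)) :=
             g :* s :* c :* (A :+ A)) refl scale (g i) (ι A) (ι s) ⟩
      g i ℚ.* ι s ℚ.* scale ℚ.* (ι A ℚ.+ ι A)
        ≡⟨ Rat.divide 0<2A ⟩
      g i ℚ.* ι s ∎
      where
      v' : a i ℚ.+ δ ℚ.≤ scale ℚ.* (g i ℚ.* (ι A ℚ.* ι s))
      v' = ℚₚ.≤-trans v (ℚₚ.*-monoˡ-≤-nonNeg scale
        {{ℚ.nonNegative (ℚₚ.<⇒≤ (Rat.0<1/ 0<2A))}}
        (ℚₚ.*-monoˡ-≤-nonNeg (g i) {{ℚ.nonNegative (0≤g i)}} u))

  -- The conclusion is a negation, so `α<` assumes the strict reverse. Growth of the exponential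
  -- then puts n p above `threshold s`, while packing puts it at or below.
  error-bound : ∀ {n} (ε : ℝ) → Eventually (λ i → ℚ.∣ seq (exp ε) i ∣ ℚ.≤ ι E) →
    (M : Mechanism n) → EdgeDP ε M → ∀ γ (0<γ : 0ℝ < γ) α p → 0ℝ < p → p ≤ 1ℝ →
    Accurate γ 0<γ α p M → fromℕ (suc (threshold 2)) ≤ fromℕ n * p →
    ∀ ℓ → IsLog (fromℕ n * p) ℓ →
    fromℚ scale * (inverse γ 0<γ * ℓ) ≤ α
  error-bound {n} ε exp≤E M dp γ 0<γ α p (π , 0<π , π≤p) p≤1 accurate N₀≤np ℓ isLog α< =
    let (s , upper , lower) = approximate-multiple A {{A-nonZero}} 2≤A (cauchy ℓ)
    in impossible s upper lower
    where
    module _ (s : ℕ) (upper : Eventually (λ i → seq ℓ i ℚ.≤ ι A ℚ.* ι s))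
             (lower : ∀ k → suc (suc k) ≡ s → Eventually (λ i → ι A ℚ.* ι k ℚ.≤ seq ℓ i)) where
      m = n ℕ.∸ (s ℕ.+ s)
      T<np : (λ _ → ι (suc (threshold s))) ≲ (λ i → ι n ℚ.* seq p i)
      T<np = threshold≲ ℓ (≈⇒≲ (exp ℓ) (fromℕ n * p) isLog)
        (≤⇒≲ (fromℕ (suc (threshold 2))) (fromℕ n * p) N₀≤np) s lower
      -- Since p ≤ 1, the bound on n p passes to n.
      T<n : threshold s ℕ.< n
      T<n = ι-cancel-≲ (suc (threshold s)) n (≲-trans T<np (≲-trans (≲-* (ι n) (0≤ι n) (≤⇒≲ p 1ℝ p≤1))
        (≡⇒≲ λ _ → ℚₚ.*-identityʳ (ι n))))
      4s≤n : (s ℕ.+ s) ℕ.+ (s ℕ.+ s) ℕ.≤ n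
      4s≤n = ℕₚ.≤-trans (4s≤threshold s) (ℕₚ.<⇒≤ T<n)
      2s≤n : s ℕ.+ s ℕ.≤ n
      2s≤n = ℕₚ.≤-trans (ℕₚ.m≤m+n (s ℕ.+ s) (s ℕ.+ s)) 4s≤n
      n≤2m : n ℕ.≤ m ℕ.+ m
      n≤2m = ℕₚ.≤-trans (ℕₚ.≤-reflexive (sym (ℕₚ.m+[n∸m]≡n 2s≤n)))
        (ℕₚ.+-monoˡ-≤ m (ℕₚ.m+n≤o⇒m≤o∸n (s ℕ.+ s) 4s≤n))
      mp≤ : (λ i → ι m ℚ.* seq p i) ≲ (λ _ → ι (E ℕ.^ suc s))
      mp≤ = target-count-bound ε E exp≤E (0<ι E) M dp γ 0<γ α p accurate s 2s≤n
        (error-gap {a = seq α} s (inverse-nonneg γ 0<γ) upper α<)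
      -- Multiplication by the i-th term of p is monotone only where that term is nonnegative; the
      -- positive lower bound π secures this eventually.
      np≤2mp : ∀ {i} → 0ℚ ℚ.+ π ℚ.≤ seq p i →
        ι n ℚ.* seq p i ℚ.≤ ι m ℚ.* seq p i ℚ.+ ι m ℚ.* seq p i
      np≤2mp {i} h = begin
        ι n ℚ.* seq p i
          ≤⟨ ℚₚ.*-monoʳ-≤-nonNeg (seq p i) {{ℚ.nonNegative 0≤p}} (Rat.ι-mono n≤2m) ⟩
        ι (m ℕ.+ m) ℚ.* seq p i
          ≡⟨ cong (ℚ._* seq p i) (ι-+ m m) ⟩
        (ι m ℚ.+ ι m) ℚ.* seq p i
          ≡⟨ ℚₚ.*-distribʳ-+ (seq p i) (ι m) (ι m) ⟩
        ι m ℚ.* seq p i ℚ.+ ι m ℚ.* seq p i ∎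
        where
        open ℚₚ.≤-Reasoning
        0≤p : 0ℚ ℚ.≤ seq p i
        0≤p = ℚₚ.≤-trans (ℚₚ.<⇒≤ 0<π) (ℚₚ.≤-trans (ℚₚ.≤-reflexive (sym (ℚₚ.+-identityˡ π))) h)
      np≤T : (λ i → ι n ℚ.* seq p i) ≲ (λ _ → ι (threshold s))
      np≤T = ≲-trans (eventually⇒≲ (ev-map np≤2mp π≤p)) (≲-trans (≲-+ mp≤ mp≤)
        (≡⇒≲ λ _ → sym (ι-+ (E ℕ.^ suc s) (E ℕ.^ suc s))))
      impossible : ⊥
      impossible = ℕₚ.1+n≰n (ι-cancel-≲ (suc (threshold s)) (threshold s) (≲-trans T<np np≤T))

-- The offset 2 guarantees E ≥ 2, as needed for s ≤ E^s.
exp-bound : ∀ ε → ∃ λ E → Eventually (λ i → ℚ.∣ seq (exp ε) i ∣ ℚ.≤ ι (2 ℕ.+ E))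
exp-bound ε =
  let (B , _ , ev) = Rat.Cauchy⇒bounded (seq (exp ε)) (cauchy (exp ε))
      (b , B≤b) = Rat.ι≥ B
  in b , ev-map (λ h → ℚₚ.≤-trans h (ℚₚ.≤-trans B≤b (Rat.ι-mono (ℕₚ.m≤n+m b 2)))) ev

mainTheorem4 : ∀ (ε : ℝ) → 0ℝ < ε →
    ∃ λ (c : ℝ) → 0ℝ < c ×
    (∀ (γ : ℝ) (1≤γ : 1ℝ ≤ γ) →
    ∃ λ (N₀ : ℝ) →
    ∀ (n : ℕ) (p α : ℝ) → 0ℝ < p → p ≤ 1ℝ → 0ℝ ≤ α →
    (M : Mechanism n) → EdgeDP ε M → Accurate γ (1≤⇒0< {γ} 1≤γ) α p M →
    N₀ ≤ fromℕ n * p →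
    ∀ (ℓ : ℝ) → IsLog (fromℕ n * p) ℓ →
    c * (inverse γ (1≤⇒0< {γ} 1≤γ) * ℓ) ≤ α)
mainTheorem4 ε _ =
  let (b , exp≤E) = exp-bound ε
      E = 2 ℕ.+ b
      2≤E = ℕₚ.m≤m+n 2 b
  in fromℚ (scale E 2≤E) , 0<scale E 2≤E , λ γ 1≤γ →
     -- N₀ = 2 E^3 + 1 settles the cases s ≤ 2, with the same value for every γ.
     fromℕ (suc (threshold E 2≤E 2)) , λ n p α 0<p p≤1 _ M dp accurate N₀≤np ℓ isLog →
     error-bound E 2≤E ε exp≤E M dp γ (1≤⇒0< {γ} 1≤γ) α p 0<p p≤1 accurate N₀≤np ℓ isLog
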